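{- Let $U=(U(n))_{n\ge 0}$ be a positional numeration system for which there is an adder, and let $\mathbf{x}$ be a $U$-automatic sequence. Then the reflection complexity $(r_{\mathbf{x}}(n))_{n\ge 0}$ is a $U$-regular sequence. Furthermore, a linear representation for $(r_{\mathbf{x}}(n))_{n\ge 0}$ is computable from a DFAO generating $\mathbf{x}$.
   Context: A positional numeration system is an increasing integer sequence $U=(U(n))_{n\ge0}$ with $U(0)=1$; the $U$-representation $\mathrm{rep}_U(n)=c(t)\cdots c(0)$ of $n$ is obtained greedily so that $n=\sum_i c(i)U(i)$ (with $\mathrm{rep}_U(0)=\varepsilon$, and a nonzero leading digit otherwise). $U$ has an adder if the set of triples $(a,b,c)$ with $a+b=c$ is recognizable by a finite automaton reading (suitably padded) $U$-representations in parallel. A sequence $\mathbf{x}$ is $U$-automatic if there is a deterministic finite automaton with output (DFAO) $\mathcal{A}$ such that $\mathbf{x}(n)=\mathcal{A}(\mathrm{rep}_U(n))$ for all $n\ge0$. An integer sequence $s$ is $U$-regular if there exist $d\ge1$, a row vector $\lambda$, a column vector $\gamma$ and a monoid morphism $\mu$ from digit words to $d\times d$ matrices (a linear representation) with $s(n)=\lambda\,\mu(\mathrm{rep}_U(n))\,\gamma$ for all $n$. A factor of a sequence is a finite contiguous block; the reversal of $u=u(1)\cdots u(m)$ is $u^R=u(m)\cdots u(1)$; $r_{\mathbf{x}}(n)$ is the number of distinct length-$n$ factors of $\mathbf{x}$ up to the equivalence $u\sim v \iff v\in\{u,u^R\}$. -}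

module Defs where

open import Data.Nat using (ℕ; zero; suc; _+_; _≤_; _<_; _≤?_; z≤n; s≤s; NonZero; >-nonZero)
open import Data.Nat.DivMod using (_/_; _%_)
open import Data.Nat.Properties using (≤-trans; <⇒≤)
open import Data.Integer using (ℤ; +_) renaming (_+_ to _+ℤ_; _*_ to _*ℤ_)
open import Data.Fin using (Fin)
open import Data.List using (List; []; _∷_; length; filter; upTo; map; replicate; _++_; reverse; foldr)
open import Data.List.Relation.Unary.All using (All)
open import Data.List.Relation.Unary.Any using (Any)
open import Data.List.Relation.Unary.AllPairs using (AllPairs)
open import Data.Product using (Σ; _×_; _,_; proj₁; proj₂; ∃)
open import Data.Sum using (_⊎_)
open import Relation.Binary.PropositionalEquality using (_≡_)
open import Relation.Nullary using (¬_)
open import Function.Bundles using (_⇔_)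
open import Data.Bool using (Bool; T)

record NumSys : Set where
  field
    U     : ℕ → ℕ
    U0    : U 0 ≡ 1
    U-inc : ∀ n → U n < U (suc n)

module _ (S : NumSys) where
  open NumSys S

  U-pos : ∀ i → 0 < U i
  U-pos zero rewrite U0 = s≤s z≤n
  U-pos (suc i) = ≤-trans (s≤s z≤n) (U-inc i)

  digitsFrom : ℕ → ℕ → List ℕ
  digitsFrom zero r = (_/_ r (U 0) {{>-nonZero (U-pos 0)}}) ∷ []
  digitsFrom (suc i) r =
    (_/_ r (U (suc i)) {{>-nonZero (U-pos (suc i))}})
      ∷ digitsFrom i (_%_ r (U (suc i)) {{>-nonZero (U-pos (suc i))}})

  -- number of indices i (among 0..n) with U(i) ≤ n; since U is strictly
  -- increasing with U(0)=1, this is t+1 where t is the largest index with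
  -- U(t) ≤ n (and it is 0 for n = 0).
  repLength : ℕ → ℕ
  repLength n = length (filter (λ i → U i ≤? n) (upTo (suc n)))

  rep : ℕ → List ℕ
  rep n with repLength n
  ... | zero  = []
  ... | suc t = digitsFrom t n

record DFA (A : Set) : Set where
  field
    nStates : ℕ
    start   : Fin nStates
    δ       : Fin nStates → A → Fin nStates
    final   : Fin nStates → Bool

  run : Fin nStates → List A → Fin nStates
  run q []      = q
  run q (a ∷ w) = run (δ q a) w

  Accepts : List A → Set
  Accepts w = T (final (run start w))

record DFAO (A : Set) (Δ : Set) : Set where
  field
    nStates : ℕ
    start   : Fin nStates
    δ       : Fin nStates → A → Fin nStates
    τ       : Fin nStates → Δ

  run : Fin nStates → List A → Fin nStates
  run q []      = q
  run q (a ∷ w) = run (δ q a) w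

  output : List A → Δ
  output w = τ (run start w)

module _ (S : NumSys) where

  IsPaddedRep : List ℕ → ℕ → Set
  IsPaddedRep w n = Σ ℕ λ k → w ≡ replicate k 0 ++ rep S n

  AddLanguage : List (ℕ × ℕ × ℕ) → Set
  AddLanguage w =
    Σ ℕ λ a → Σ ℕ λ b → Σ ℕ λ c →
      IsPaddedRep (map proj₁ w) a ×
      IsPaddedRep (map (λ t → proj₁ (proj₂ t)) w) b ×
      IsPaddedRep (map (λ t → proj₂ (proj₂ t)) w) c ×
      (a + b ≡ c)

  HasAdder : Set
  HasAdder =
    Σ ℕ λ β →
      (∀ n → All (_< β) (rep S n)) ×
      Σ (DFA (ℕ × ℕ × ℕ)) λ M → ∀ w → DFA.Accepts M w ⇔ AddLanguage w

  IsAutomatic : {Δ : Set} → (ℕ → Δ) → Set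
  IsAutomatic {Δ} x = Σ (DFAO ℕ Δ) λ A → ∀ n → x n ≡ DFAO.output A (rep S n)

Mat : ℕ → Set
Mat d = Fin d → Fin d → ℤ

sumFin : ∀ {d} → (Fin d → ℤ) → ℤ
sumFin {zero}  f = + 0
sumFin {suc d} f = f Fin.zero +ℤ sumFin (λ i → f (Fin.suc i))

_⊗_ : ∀ {d} → Mat d → Mat d → Mat d
(M ⊗ N) i j = sumFin (λ k → M i k *ℤ N k j)

idMat : ∀ {d} → Mat d
idMat Fin.zero    Fin.zero    = + 1
idMat Fin.zero    (Fin.suc j) = + 0
idMat (Fin.suc i) Fin.zero    = + 0
idMat (Fin.suc i) (Fin.suc j) = idMat i j

μ* : ∀ {d} → (ℕ → Mat d) → List ℕ → Mat d
μ* μ w = foldr (λ a M → μ a ⊗ M) idMat w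

evalRep : ∀ {d} → (Fin d → ℤ) → (ℕ → Mat d) → (Fin d → ℤ) → List ℕ → ℤ
evalRep λv μ γ w = sumFin (λ i → sumFin (λ j → λv i *ℤ (μ* μ w i j *ℤ γ j)))

record LinRep : Set where
  field
    dim  : ℕ
    dim≥1 : 1 ≤ dim
    λv   : Fin dim → ℤ
    μ    : ℕ → Mat dim
    γ    : Fin dim → ℤ

Represents : (S : NumSys) → LinRep → (ℕ → ℤ) → Set
Represents S L s = ∀ n → s n ≡ evalRep λv μ γ (rep S n)
  where open LinRep L

IsRegular : NumSys → (ℕ → ℤ) → Set
IsRegular S s = Σ LinRep λ L → Represents S L s

module _ {Δ : Set} (x : ℕ → Δ) where

  factor : ℕ → ℕ → List Δ
  factor i n = map (λ j → x (i + j)) (upTo n)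

  IsFactor : ℕ → List Δ → Set
  IsFactor n w = Σ ℕ λ i → factor i n ≡ w

  _∼_ : List Δ → List Δ → Set
  u ∼ v = (v ≡ u) ⊎ (v ≡ reverse u)

  -- N is the number of length-n factors of x up to ∼ : there is a list of N
  -- length-n factors, pairwise inequivalent, such that every length-n factor
  -- is equivalent to one of them.
  IsReflComplexity : ℕ → ℕ → Set
  IsReflComplexity n N =
    Σ (List (List Δ)) λ L →
      (length L ≡ N) ×
      All (IsFactor n) L ×
      AllPairs (λ u v → ¬ (u ∼ v)) L ×
      (∀ i → Any (λ w → factor i n ∼ w) L)

{-# OPTIONS --safe #-}
-- Call i a first occurrence for n if the length-n factor of x at i is equivalent (equal or
-- reversed) to no factor starting earlier, so that r_x(n) is the number of first occurrences.
-- With an adder, every relation on ℕ that is first-order definable from + and x(i) = x(j) is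
-- recognised by an automaton reading padded representations in parallel (products for ∧,
-- complements for ¬, a subset construction for ∃), and "i is a first occurrence for n" is such
-- a relation; let s be the number of states of its automaton 𝒜. Pumping the leading digits of i
-- shows |rep i| ≤ s + |rep n| for every first occurrence i: otherwise there would be infinitely
-- many of them, while distinct first occurrences carry distinct factors of length n. Hence
-- r_x(n) is the number of digit words e such that 𝒜 accepts e read against 0^s rep n, and
-- counting accepting runs column by column gives r_x(n) = λ μ(rep n) γ with
-- μ(c)_{pq} = #{d : δ(p, (d, c)) = q}, λ counting runs on the zero prefix, γ marking acceptance.
module Submission where

open import Defs
open import Data.Nat using (ℕ; zero; suc; _+_; _*_; _∸_; _≤_; _<_; _≤?_; z≤n; s≤s; >-nonZero)
open import Data.Nat.Properties hiding (_≟_)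
import Data.Nat.Properties as ℕₚ
open import Data.Integer using (ℤ; +_)
import Data.Integer as ℤ
import Data.Integer.Properties as ℤₚ
import Algebra.Properties.Semiring.Sum
open import Data.Nat.DivMod using (_/_; _%_; m≡m%n+[m/n]*n; m%n<n; m≥n⇒m/n>0)
open import Data.Bool using (Bool; true; false; T; _∧_; not; if_then_else_)
open import Data.Bool.Properties using (T-∧)
open import Data.Fin using (Fin; toℕ; #_) renaming (zero to fzero; suc to fsuc)
import Data.Fin.Properties as Fin
open import Data.Maybe using (Maybe; nothing; just)
open import Data.List using
  (List; []; _∷_; _∷ʳ_; length; filter; upTo; applyUpTo; map; replicate; reverse; _++_; foldl; zipWith; take; drop; concat;
   allFin; cartesianProduct; cartesianProductWith; lookup)
open import Data.Nat.ListAction using (sum)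
open import Data.Nat.ListAction.Properties using (sum-++)
open import Data.List.Properties using
  (length-++; length-replicate; length-map; length-upTo; length-take; length-drop; take++drop≡id; ++-assoc; ++-identityʳ;
   ∷-injective; ∷-injectiveˡ; ∷ʳ-injective; upTo-∷ʳ; filter-++; filter-accept; filter-reject; foldl-++; foldl-map; map-∘;
   map-cong; map-cong-local; map-++; map-upTo; map-applyUpTo; reverse-++; reverse-involutive; ≡-dec)
open import Data.List.Relation.Unary.All using (All; []; _∷_)
import Data.List.Relation.Unary.All as All
import Data.List.Relation.Unary.All.Properties as Allₚ
open import Data.List.Relation.Unary.Any using (Any; here; there)
import Data.List.Relation.Unary.Any as Any
open import Data.List.Relation.Unary.Any.Properties using (lookup-index)
import Data.List.Relation.Unary.Any.Properties as Anyₚ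
open import Data.List.Membership.Propositional using (_∈_; find; lose)
open import Data.List.Membership.Propositional.Properties using
  (∈-filter⁺; ∈-filter⁻; ∈-∃++; ∈-++⁻; ∈-++⁺ˡ; ∈-++⁺ʳ; ∈-allFin; ∈-map⁺; ∈-cartesianProduct⁺; ∈-cartesianProductWith⁺;
   ∈-cartesianProductWith⁻; ∈-upTo⁺; ∈-upTo⁻)
open import Data.List.Relation.Unary.Unique.Propositional using (Unique)
open import Data.List.Relation.Unary.AllPairs using (AllPairs; []; _∷_)
import Data.List.Relation.Unary.AllPairs.Properties as AllPairsₚ
import Data.List.Relation.Unary.Unique.Propositional.Properties as Unique
open import Data.Vec using (Vec) renaming ([] to []ᵛ; _∷_ to _∷ᵛ_)
import Data.Vec as V
import Data.Vec.Properties as V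
open import Data.Product using (Σ; ∃; ∃-syntax; _×_; _,_; proj₁; proj₂)
open import Data.Sum using (_⊎_; inj₁; inj₂; [_,_]′)
open import Data.Empty using (⊥; ⊥-elim)
open import Function using (id; _∘_; _∘′_; _⇔_; mk⇔; Equivalence; case_of_)
import Function.Properties.Equivalence as ⇔
open import Data.Product.Function.NonDependent.Propositional using (_×-⇔_)
open import Relation.Binary.PropositionalEquality using (_≡_; _≢_; refl; sym; trans; cong; cong₂; subst; subst₂; module ≡-Reasoning)
open import Relation.Binary.Definitions using (DecidableEquality; tri<; tri≈; tri>)
open import Relation.Nullary using (¬_; Dec; yes; no; does)
open import Relation.Nullary.Decidable using (decidable-stable; map′; _×-dec_; _⊎-dec_; T?; isYes; toWitness; fromWitness)
open import Relation.Unary using (Decidable)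

-- Greedy representations

record InitialSegment (P : ℕ → Set) (N L : ℕ) : Set where
  field
    bounded : L ≤ N
    below   : ∀ {i} → i < L → P i
    stops   : L < N → ¬ P L

module _ {P : ℕ → Set} (P? : Decidable P) (down : ∀ {i} → P (suc i) → P i) where

  downClosed : ∀ {i j} → i ≤ j → P j → P i
  downClosed {j = zero}  z≤n pj = pj
  downClosed {i} {suc j} i≤j pj with m≤n⇒m<n∨m≡n i≤j
  ... | inj₁ i<1+j = downClosed (≤-pred i<1+j) (down pj)
  ... | inj₂ refl  = pj

  private
    countBelow : ℕ → ℕ
    countBelow N = length (filter P? (upTo N))

    countBelow-suc : ∀ N → countBelow (suc N) ≡ countBelow N + length (filter P? (N ∷ []))
    countBelow-suc N = begin
      length (filter P? (upTo (suc N)))                  ≡⟨ cong (length ∘′ filter P?) (upTo-∷ʳ N) ⟨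
      length (filter P? (upTo N ++ N ∷ []))              ≡⟨ cong length (filter-++ P? (upTo N) (N ∷ [])) ⟩
      length (filter P? (upTo N) ++ filter P? (N ∷ []))  ≡⟨ length-++ (filter P? (upTo N)) ⟩
      countBelow N + length (filter P? (N ∷ []))         ∎
      where open ≡-Reasoning

  filter-upTo-initialSegment : ∀ N → InitialSegment P N (countBelow N)
  filter-upTo-initialSegment zero = record { bounded = z≤n ; below = λ () ; stops = λ () }
  filter-upTo-initialSegment (suc N) with filter-upTo-initialSegment N | P? N
  ... | seg | yes pN = record
    { bounded = ≤-reflexive count≡
    ; below   = λ i<L → downClosed (≤-pred (≤-trans i<L (≤-reflexive count≡))) pN
    ; stops   = λ L<1+N → ⊥-elim (<-irrefl count≡ L<1+N) }
    where
      open InitialSegment seg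
      count≡ : countBelow (suc N) ≡ suc N
      count≡ with m≤n⇒m<n∨m≡n bounded
      ... | inj₁ L<N = ⊥-elim (stops L<N (downClosed (<⇒≤ L<N) pN))
      ... | inj₂ L≡N = begin
        countBelow (suc N)                          ≡⟨ countBelow-suc N ⟩
        countBelow N + length (filter P? (N ∷ []))  ≡⟨ cong (λ l → countBelow N + length l) (filter-accept P? pN) ⟩
        countBelow N + 1                            ≡⟨ cong (_+ 1) L≡N ⟩
        N + 1                                       ≡⟨ +-comm N 1 ⟩
        suc N                                       ∎
        where open ≡-Reasoning
  ... | seg | no ¬pN = record
    { bounded = ≤-trans (≤-reflexive count≡) (m≤n⇒m≤1+n bounded)
    ; below   = λ i<L → below (≤-trans i<L (≤-reflexive count≡))
    ; stops   = stops′ }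
    where
      open InitialSegment seg
      count≡ : countBelow (suc N) ≡ countBelow N
      count≡ = trans (countBelow-suc N) (trans (cong (λ l → countBelow N + length l) (filter-reject P? ¬pN)) (+-identityʳ (countBelow N)))
      stops′ : countBelow (suc N) < suc N → ¬ P (countBelow (suc N))
      stops′ L<1+N rewrite count≡ with m≤n⇒m<n∨m≡n (≤-pred L<1+N)
      ... | inj₁ L<N = stops L<N
      ... | inj₂ L≡N = subst (λ k → ¬ P k) (sym L≡N) ¬pN

length-replicate++ : ∀ {A : Set} k {a : A} w → length (replicate k a ++ w) ≡ k + length w
length-replicate++ k w = trans (length-++ (replicate k _)) (cong (_+ length w) (length-replicate k))

module Representation (S : NumSys) where
  open NumSys S

  value : List ℕ → ℕ
  value []      = 0
  value (d ∷ w) = d * U (length w) + value w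

  value-zeros++ : ∀ k w → value (replicate k 0 ++ w) ≡ value w
  value-zeros++ zero    w = refl
  value-zeros++ (suc k) w = value-zeros++ k w

  length-digitsFrom : ∀ t r → length (digitsFrom S t r) ≡ suc t
  length-digitsFrom zero    r = refl
  length-digitsFrom (suc t) r = cong suc (length-digitsFrom t _)

  value-digitsFrom : ∀ t r → value (digitsFrom S t r) ≡ r
  value-digitsFrom zero r = begin
    r / U 0 * U 0 + 0        ≡⟨ +-identityʳ _ ⟩
    r / U 0 * U 0            ≡⟨ cong (_+ r / U 0 * U 0) r%U0≡0 ⟨
    r % U 0 + r / U 0 * U 0  ≡⟨ m≡m%n+[m/n]*n r (U 0) ⟨
    r                        ∎
    where
      open ≡-Reasoning
      instance _ = >-nonZero (U-pos S 0)
      r%U0≡0 : r % U 0 ≡ 0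
      r%U0≡0 = n<1⇒n≡0 (subst (r % U 0 <_) U0 (m%n<n r (U 0)))
  value-digitsFrom (suc t) r = begin
    q * U (length (digitsFrom S t ρ)) + value (digitsFrom S t ρ)
      ≡⟨ cong₂ (λ a b → q * U a + b) (length-digitsFrom t ρ) (value-digitsFrom t ρ) ⟩
    q * U (suc t) + ρ    ≡⟨ +-comm _ ρ ⟩
    ρ + q * U (suc t)    ≡⟨ m≡m%n+[m/n]*n r (U (suc t)) ⟨
    r                    ∎
    where
      open ≡-Reasoning
      instance _ = >-nonZero (U-pos S (suc t))
      q = r / U (suc t)
      ρ = r % U (suc t)

  U-strictMono : ∀ {i j} → i < j → U i < U j
  U-strictMono {i} {suc j} i<1+j with m≤n⇒m<n∨m≡n (≤-pred i<1+j)
  ... | inj₁ i<j  = <-trans (U-strictMono i<j) (U-inc j)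
  ... | inj₂ refl = U-inc i

  U-mono : ∀ {i j} → i ≤ j → U i ≤ U j
  U-mono i≤j with m≤n⇒m<n∨m≡n i≤j
  ... | inj₁ i<j  = <⇒≤ (U-strictMono i<j)
  ... | inj₂ refl = ≤-refl

  n<U[n] : ∀ i → i < U i
  n<U[n] zero    = U-pos S 0
  n<U[n] (suc i) = ≤-trans (s≤s (n<U[n] i)) (U-inc i)

  private
    indices : ∀ n → InitialSegment (λ i → U i ≤ n) (suc n) (repLength S n)
    indices n = filter-upTo-initialSegment (λ i → U i ≤? n) (λ U[1+i]≤n → ≤-trans (<⇒≤ (U-inc _)) U[1+i]≤n) (suc n)

  <U[repLength] : ∀ n → n < U (repLength S n)
  <U[repLength] n with m≤n⇒m<n∨m≡n (InitialSegment.bounded (indices n))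
  ... | inj₁ L<1+n = ≰⇒> (InitialSegment.stops (indices n) L<1+n)
  ... | inj₂ L≡1+n rewrite L≡1+n = <-trans (n<1+n n) (n<U[n] (suc n))

  repLength≡suc⇒U≤ : ∀ n t → repLength S n ≡ suc t → U t ≤ n
  repLength≡suc⇒U≤ n t L≡1+t = InitialSegment.below (indices n) (≤-reflexive (sym L≡1+t))

  repLength≡0⇒≡0 : ∀ n → repLength S n ≡ 0 → n ≡ 0
  repLength≡0⇒≡0 n L≡0 = n<1⇒n≡0 (subst (n <_) (trans (cong U L≡0) U0) (<U[repLength] n))

  value-rep : ∀ n → value (rep S n) ≡ n
  value-rep n with repLength S n in L≡
  ... | zero  = sym (repLength≡0⇒≡0 n L≡)
  ... | suc t = value-digitsFrom t n

  length-rep : ∀ n → length (rep S n) ≡ repLength S n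
  length-rep n with repLength S n
  ... | zero  = refl
  ... | suc t = length-digitsFrom t n

  rep-0 : rep S 0 ≡ []
  rep-0 with repLength S 0 in L≡
  ... | zero  = refl
  ... | suc t = ⊥-elim (<⇒≱ (U-pos S t) (repLength≡suc⇒U≤ 0 t L≡))

  private
    digitsFrom-leading : ∀ t r → ∃[ w ] digitsFrom S t r ≡ (_/_ r (U t) {{>-nonZero (U-pos S t)}}) ∷ w
    digitsFrom-leading zero    r = [] , refl
    digitsFrom-leading (suc t) r = _ , refl

  rep-leading≢0 : ∀ n {d w} → rep S n ≡ d ∷ w → d ≢ 0
  rep-leading≢0 n eq with repLength S n in L≡
  rep-leading≢0 n () | zero
  rep-leading≢0 n eq | suc t with digitsFrom-leading t n
  ... | _ , eq′ = λ d≡0 → <⇒≢ leading>0 (sym (trans (∷-injectiveˡ (trans (sym eq′) eq)) d≡0))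
    where
      instance _ = >-nonZero (U-pos S t)
      leading>0 : 0 < n / U t
      leading>0 = m≥n⇒m/n>0 (repLength≡suc⇒U≤ n t L≡)

  padded-value : ∀ {w n} → IsPaddedRep S w n → value w ≡ n
  padded-value {n = n} (k , refl) = trans (value-zeros++ k (rep S n)) (value-rep n)

  padded-injective : ∀ {w a b} → IsPaddedRep S w a → IsPaddedRep S w b → a ≡ b
  padded-injective pa pb = trans (sym (padded-value pa)) (padded-value pb)

  rep-isPadded : ∀ n → IsPaddedRep S (rep S n) n
  rep-isPadded n = 0 , refl

  zeros-isPadded : ∀ k → IsPaddedRep S (replicate k 0) 0
  zeros-isPadded k = k , sym (trans (cong (replicate k 0 ++_) rep-0) (++-identityʳ _))

  zeros++-isPadded : ∀ k {w n} → IsPaddedRep S w n → IsPaddedRep S (replicate k 0 ++ w) n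
  zeros++-isPadded k {n = n} (j , refl) =
    k + j , trans (sym (++-assoc (replicate k 0) (replicate j 0) (rep S n))) (cong (_++ rep S n) (replicate-+ k j))
    where
      replicate-+ : ∀ a b → replicate a 0 ++ replicate b 0 ≡ replicate (a + b) 0
      replicate-+ zero    b = refl
      replicate-+ (suc a) b = cong (0 ∷_) (replicate-+ a b)

  leading≢0-padded⇒rep : ∀ {d w n} → IsPaddedRep S (d ∷ w) n → d ≢ 0 → d ∷ w ≡ rep S n
  leading≢0-padded⇒rep (zero  , eq)   _   = eq
  leading≢0-padded⇒rep (suc k , refl) d≢0 = ⊥-elim (d≢0 refl)

  length-rep≤⇒<U : ∀ i ℓ → length (rep S i) ≤ ℓ → i < U ℓ
  length-rep≤⇒<U i ℓ len≤ℓ = <-≤-trans (<U[repLength] i) (U-mono (subst (_≤ ℓ) (length-rep i) len≤ℓ))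

  <U⇒length-rep≤ : ∀ i ℓ → i < U ℓ → length (rep S i) ≤ ℓ
  <U⇒length-rep≤ i ℓ i<Uℓ rewrite length-rep i with repLength S i in L≡
  ... | zero  = z≤n
  ... | suc t = ≮⇒≥ λ ℓ<1+t → <⇒≱ i<Uℓ (≤-trans (U-mono (≤-pred ℓ<1+t)) (repLength≡suc⇒U≤ i t L≡))

  padded⇒length-rep≤ : ∀ {w n} → IsPaddedRep S w n → length (rep S n) ≤ length w
  padded⇒length-rep≤ {n = n} (k , refl) = subst (length (rep S n) ≤_) (sym (length-++ (replicate k 0))) (m≤n+m _ _)

  alphabet-nonempty : ∀ {β} → (∀ n → All (_< β) (rep S n)) → 0 < β
  alphabet-nonempty digits<β with rep S 1 in eq | digits<β 1
  ... | []    | _       = ⊥-elim (1+n≢0 (trans (sym (value-rep 1)) (cong value eq)))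
  ... | _ ∷ _ | d<β ∷ _ = ≤-<-trans z≤n d<β

  -- no padding at all when rep_U(i) is longer than ℓ (truncated subtraction)
  pad : ℕ → ℕ → List ℕ
  pad ℓ i = replicate (ℓ ∸ length (rep S i)) 0 ++ rep S i

  pad-isPadded : ∀ ℓ i → IsPaddedRep S (pad ℓ i) i
  pad-isPadded ℓ i = _ , refl

  length-pad : ∀ ℓ i → length (rep S i) ≤ ℓ → length (pad ℓ i) ≡ ℓ
  length-pad ℓ i len≤ℓ = trans (length-replicate++ (ℓ ∸ length (rep S i)) (rep S i)) (m∸n+n≡m len≤ℓ)

  padded⇒≡pad : ∀ {w n} → IsPaddedRep S w n → w ≡ pad (length w) n
  padded⇒≡pad {n = n} (k , refl) = cong (λ j → replicate j 0 ++ rep S n) (sym k≡)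
    where
      k≡ : length (replicate k 0 ++ rep S n) ∸ length (rep S n) ≡ k
      k≡ = trans (cong (_∸ length (rep S n)) (length-replicate++ k (rep S n))) (m+n∸n≡m k (length (rep S n)))

  pad-injective : ∀ {ℓ a b} → pad ℓ a ≡ pad ℓ b → a ≡ b
  pad-injective {ℓ} {a} {b} eq = padded-injective (pad-isPadded ℓ a) (subst (λ w → IsPaddedRep S w b) (sym eq) (pad-isPadded ℓ b))

-- Finite automata

record Finite (Q : Set) : Set where
  field
    elements : List Q
    complete : ∀ q → q ∈ elements

  size : ℕ
  size = length elements

  index : Q → Fin size
  index q = Any.index (complete q)

  element : Fin size → Q
  element = lookup elements

  element-index : ∀ q → element (index q) ≡ q
  element-index q = sym (lookup-index (complete q))

  index-injective : ∀ {p q} → index p ≡ index q → p ≡ q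
  index-injective {p} {q} eq = trans (sym (element-index p)) (trans (cong element eq) (element-index q))

  _≟_ : DecidableEquality Q
  p ≟ q = map′ index-injective (cong index) (index p Fin.≟ index q)

Fin-finite : ∀ n → Finite (Fin n)
Fin-finite n = record { elements = allFin n ; complete = ∈-allFin }

×-finite : ∀ {P Q} → Finite P → Finite Q → Finite (P × Q)
×-finite FP FQ = record
  { elements = cartesianProduct (Finite.elements FP) (Finite.elements FQ)
  ; complete = λ (p , q) → ∈-cartesianProduct⁺ (Finite.complete FP p) (Finite.complete FQ q) }

Maybe-finite : ∀ {Q} → Finite Q → Finite (Maybe Q)
Maybe-finite FQ = record
  { elements = nothing ∷ map just (Finite.elements FQ)
  ; complete = λ { nothing → here refl ; (just q) → there (∈-map⁺ just (Finite.complete FQ q)) } }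

allVecs : ∀ {A : Set} → List A → (k : ℕ) → List (Vec A k)
allVecs as zero    = []ᵛ ∷ []
allVecs as (suc k) = cartesianProductWith _∷ᵛ_ as (allVecs as k)

BoolVec-finite : ∀ k → Finite (Vec Bool k)
BoolVec-finite k = record { elements = allVecs (true ∷ false ∷ []) k ; complete = complete }
  where
    bools : ∀ b → b ∈ true ∷ false ∷ []
    bools true  = here refl
    bools false = there (here refl)
    complete : ∀ {k} (X : Vec Bool k) → X ∈ allVecs (true ∷ false ∷ []) k
    complete []ᵛ      = here refl
    complete (b ∷ᵛ X) = ∈-cartesianProductWith⁺ _∷ᵛ_ (bools b) (complete X)

take-+ : ∀ {A : Set} a k (u : List A) → take (a + k) u ≡ take a u ++ take k (drop a u)
take-+ zero    k       u       = refl
take-+ (suc a) zero    []      = refl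
take-+ (suc a) (suc k) []      = refl
take-+ (suc a) k       (c ∷ u) = cong (c ∷_) (take-+ a k u)

++-nonempty : ∀ {A : Set} (a b : List A) → 0 < length b → ∃ λ c → ∃ λ cs → a ++ b ≡ c ∷ cs
++-nonempty []      (c ∷ b) _ = c , b , refl
++-nonempty (c ∷ a) b       _ = c , a ++ b , refl

length-concat-replicate : ∀ {A : Set} N (y : List A) → length (concat (replicate N y)) ≡ N * length y
length-concat-replicate zero    y = refl
length-concat-replicate (suc N) y = trans (length-++ y) (cong (λ k → length y + k) (length-concat-replicate N y))

module _ {Q A : Set} (F : Finite Q) (δ : Q → A → Q) where
  open Finite F

  run-loop : ∀ q u → size < length u →
    ∃ λ x → ∃ λ y → ∃ λ z → u ≡ x ++ y ++ z × 0 < length y × foldl δ q (x ++ y) ≡ foldl δ q x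
  run-loop q u size<|u| with Fin.pigeonhole (n<1+n size) (λ i → index (foldl δ q (take (toℕ i) u)))
  ... | i , j , i<j , same = x , y , z , u≡ , 0<|y| , loop
    where
      a = toℕ i
      k = toℕ j ∸ a
      x = take a u
      y = take k (drop a u)
      z = drop k (drop a u)
      u≡ : u ≡ x ++ y ++ z
      u≡ = sym (trans (cong (x ++_) (take++drop≡id k (drop a u))) (take++drop≡id a u))
      k≤ : k ≤ length (drop a u)
      k≤ = subst (k ≤_) (sym (length-drop a u)) (∸-monoˡ-≤ a (≤-trans (≤-pred (Fin.toℕ<n j)) (<⇒≤ size<|u|)))
      0<|y| : 0 < length y
      0<|y| = subst (0 <_) (sym (trans (length-take k (drop a u)) (m≤n⇒m⊓n≡m k≤))) (m<n⇒0<n∸m i<j)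
      loop : foldl δ q (x ++ y) ≡ foldl δ q x
      loop = sym (begin
        foldl δ q x                     ≡⟨ index-injective same ⟩
        foldl δ q (take (toℕ j) u)      ≡⟨ cong (λ t → foldl δ q (take t u)) (m+[n∸m]≡n (<⇒≤ i<j)) ⟨
        foldl δ q (take (a + k) u)      ≡⟨ cong (foldl δ q) (take-+ a k u) ⟩
        foldl δ q (x ++ y)              ∎)
        where open ≡-Reasoning

  loop-repeat : ∀ {q} x y z → foldl δ q (x ++ y) ≡ foldl δ q x →
    ∀ N → foldl δ q (x ++ concat (replicate N y) ++ z) ≡ foldl δ q (x ++ z)
  loop-repeat x y z loop zero = refl
  loop-repeat {q} x y z loop (suc N) = begin
    foldl δ q (x ++ (y ++ Y) ++ z)         ≡⟨ cong (foldl δ q) (trans (cong (x ++_) (++-assoc y Y z)) (sym (++-assoc x y (Y ++ z)))) ⟩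
    foldl δ q ((x ++ y) ++ Y ++ z)         ≡⟨ foldl-++ δ q (x ++ y) (Y ++ z) ⟩
    foldl δ (foldl δ q (x ++ y)) (Y ++ z)  ≡⟨ cong (λ p → foldl δ p (Y ++ z)) loop ⟩
    foldl δ (foldl δ q x) (Y ++ z)         ≡⟨ foldl-++ δ q x (Y ++ z) ⟨
    foldl δ q (x ++ Y ++ z)                ≡⟨ loop-repeat x y z loop N ⟩
    foldl δ q (x ++ z)                     ∎
    where
      open ≡-Reasoning
      Y = concat (replicate N y)

  loop-remove : ∀ {q} x y z → foldl δ q (x ++ y) ≡ foldl δ q x → foldl δ q (x ++ y ++ z) ≡ foldl δ q (x ++ z)
  loop-remove {q} x y z loop =
    trans (cong (λ t → foldl δ q (x ++ t ++ z)) (sym (++-identityʳ y))) (loop-repeat x y z loop 1)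

  run-pumping : ∀ q u → size < length u →
    ∃ λ x → ∃ λ y → ∃ λ z → u ≡ x ++ y ++ z × 0 < length y ×
      (∀ N → foldl δ q (x ++ concat (replicate N y) ++ z) ≡ foldl δ q u)
  run-pumping q u size<|u| with run-loop q u size<|u|
  ... | x , y , z , refl , 0<|y| , loop =
    x , y , z , refl , 0<|y| , λ N → trans (loop-repeat x y z loop N) (sym (loop-remove x y z loop))

  run-shorten : ∀ {P : A → Set} q u → All P u →
    ∃ λ u′ → length u′ ≤ size × All P u′ × foldl δ q u′ ≡ foldl δ q u
  run-shorten {P} q u Pu = go (length u) u ≤-refl Pu
    where
      go : ∀ N u → length u ≤ N → All P u → ∃ λ u′ → length u′ ≤ size × All P u′ × foldl δ q u′ ≡ foldl δ q u
      go N u |u|≤N Pu with length u ≤? size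
      ... | yes |u|≤size = u , |u|≤size , Pu , refl
      go zero    u |u|≤0 Pu | no |u|≰size = ⊥-elim (|u|≰size (≤-trans |u|≤0 z≤n))
      go (suc N) u |u|≤1+N Pu | no |u|≰size with run-loop q u (≰⇒> |u|≰size)
      ... | x , y , z , refl , 0<|y| , loop with go N (x ++ z) |xz|≤N Pxz
        where
          |xz|≤N : length (x ++ z) ≤ N
          |xz|≤N = ≤-pred (≤-trans (subst₂ _<_ (sym (length-++ x)) (sym (length-++ x))
                     (+-monoʳ-< (length x) (subst (length z <_) (sym (length-++ y)) (m<n+m (length z) 0<|y|)))) |u|≤1+N)
          Pxz : All P (x ++ z)
          Pxz = Allₚ.++⁺ (Allₚ.++⁻ˡ x Pu) (Allₚ.++⁻ʳ y (Allₚ.++⁻ʳ x Pu))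
      ... | u′ , |u′|≤size , Pu′ , same = u′ , |u′|≤size , Pu′ , trans same (sym (loop-remove x y z loop))

allWords : ∀ {A : Set} → List A → ℕ → List (List A)
allWords as zero    = [] ∷ []
allWords as (suc k) = cartesianProductWith _∷_ as (allWords as k)

∈-allWords⁺ : ∀ {A : Set} {as : List A} {u} → All (_∈ as) u → u ∈ allWords as (length u)
∈-allWords⁺ []        = here refl
∈-allWords⁺ (a∈ ∷ u∈) = ∈-cartesianProductWith⁺ _∷_ a∈ (∈-allWords⁺ u∈)

∈-allWords⁻ : ∀ {A : Set} (as : List A) k {u} → u ∈ allWords as k → length u ≡ k × All (_∈ as) u
∈-allWords⁻ as zero    (here refl) = refl , []
∈-allWords⁻ as (suc k) u∈ with ∈-cartesianProductWith⁻ _∷_ as (allWords as k) u∈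
... | a , u′ , a∈ , u′∈ , refl = cong suc (proj₁ (∈-allWords⁻ as k u′∈)) , a∈ ∷ proj₂ (∈-allWords⁻ as k u′∈)

allWords-unique : ∀ {A : Set} {as : List A} → Unique as → ∀ k → Unique (allWords as k)
allWords-unique as! zero    = [] ∷ []
allWords-unique as! (suc k) = Unique.cartesianProductWith⁺ _∷_ ∷-injective as! (allWords-unique as! k)

indicator : Bool → ℕ
indicator b = if b then 1 else 0

count : ∀ {A : Set} → (A → Bool) → List A → ℕ
count p xs = sum (map (indicator ∘ p) xs)

count≡length-filter : ∀ {A : Set} (p : A → Bool) xs → count p xs ≡ length (filter (T? ∘ p) xs)
count≡length-filter p []       = refl
count≡length-filter p (a ∷ xs) with p a
... | true  = cong suc (count≡length-filter p xs)
... | false = count≡length-filter p xs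

sum-cartesianProduct∷ : ∀ {A : Set} (f : List A → ℕ) ds W →
  sum (map f (cartesianProductWith _∷_ ds W)) ≡ sum (map (λ d → sum (map (f ∘ (d ∷_)) W)) ds)
sum-cartesianProduct∷ f []       W = refl
sum-cartesianProduct∷ f (d ∷ ds) W = begin
  sum (map f (map (d ∷_) W ++ cartesianProductWith _∷_ ds W))
    ≡⟨ cong sum (map-++ f (map (d ∷_) W) _) ⟩
  sum (map f (map (d ∷_) W) ++ map f (cartesianProductWith _∷_ ds W))
    ≡⟨ sum-++ (map f (map (d ∷_) W)) _ ⟩
  sum (map f (map (d ∷_) W)) + sum (map f (cartesianProductWith _∷_ ds W))
    ≡⟨ cong₂ _+_ (cong sum (sym (map-∘ W))) (sum-cartesianProduct∷ f ds W) ⟩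
  sum (map (f ∘ (d ∷_)) W) + sum (map (λ d → sum (map (f ∘ (d ∷_)) W)) ds) ∎
  where open ≡-Reasoning

record Automaton (A : Set) : Set₁ where
  field
    State     : Set
    start     : State
    step      : State → A → State
    accepting : State → Bool
    finite    : Finite State

  run : State → List A → State
  run = foldl step

  Accepts : List A → Set
  Accepts w = T (accepting (run start w))

open Automaton using (Accepts)

module _ {A : Set} where

  fromDFA : DFA A → Automaton A
  fromDFA M = record
    { State = Fin (DFA.nStates M) ; start = DFA.start M ; step = DFA.δ M ; accepting = DFA.final M
    ; finite = Fin-finite (DFA.nStates M) }

  Accepts-fromDFA : ∀ M w → Accepts (fromDFA M) w ⇔ DFA.Accepts M w
  Accepts-fromDFA M w = mk⇔ (subst (T ∘ DFA.final M) (sym (run≡ _ w))) (subst (T ∘ DFA.final M) (run≡ _ w))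
    where
      run≡ : ∀ q w → DFA.run M q w ≡ foldl (DFA.δ M) q w
      run≡ q []      = refl
      run≡ q (a ∷ w) = run≡ (DFA.δ M q a) w

  comap : ∀ {B : Set} → (B → A) → Automaton A → Automaton B
  comap f M = record { Automaton M hiding (step; run; Accepts) ; step = λ q b → Automaton.step M q (f b) }

  Accepts-comap : ∀ {B : Set} (f : B → A) M w → Accepts (comap f M) w ⇔ Accepts M (map f w)
  Accepts-comap f M w = mk⇔ (subst (T ∘ accepting) (sym (foldl-map step f start w)))
                             (subst (T ∘ accepting) (foldl-map step f start w))
    where open Automaton M

  _∩ᴬ_ : Automaton A → Automaton A → Automaton A
  M ∩ᴬ N = record
    { State     = M.State × N.State
    ; start     = M.start , N.start
    ; step      = λ (p , q) a → M.step p a , N.step q a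
    ; accepting = λ (p , q) → M.accepting p ∧ N.accepting q
    ; finite    = ×-finite M.finite N.finite }
    where
      module M = Automaton M
      module N = Automaton N

  run-∩ : ∀ M N p q w → Automaton.run (M ∩ᴬ N) (p , q) w ≡ (Automaton.run M p w , Automaton.run N q w)
  run-∩ M N p q []      = refl
  run-∩ M N p q (a ∷ w) = run-∩ M N (Automaton.step M p a) (Automaton.step N q a) w

  Accepts-∩ : ∀ M N w → Accepts (M ∩ᴬ N) w ⇔ (Accepts M w × Accepts N w)
  Accepts-∩ M N w rewrite run-∩ M N (Automaton.start M) (Automaton.start N) w = T-∧

  complementᴬ : Automaton A → Automaton A
  complementᴬ M = record { Automaton M hiding (accepting; run; Accepts) ; accepting = not ∘ Automaton.accepting M }

  Accepts-complement : ∀ M w → Accepts (complementᴬ M) w ⇔ (¬ Accepts M w)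
  Accepts-complement M w = T-not
    where
      T-not : ∀ {b} → T (not b) ⇔ (¬ T b)
      T-not {true}  = mk⇔ (λ ()) (λ ¬t → ¬t _)
      T-not {false} = mk⇔ (λ _ ()) (λ _ → _)

-- Relations recognised by automata

module AutomaticRelations (S : NumSys) (β : ℕ) (digits<β : ∀ n → All (_< β) (rep S n))
         (adder : DFA (ℕ × ℕ × ℕ)) (adder-correct : ∀ w → DFA.Accepts adder w ⇔ AddLanguage S w) where
  open Representation S
  open Equivalence

  infixl 8 _!_
  _!_ : ∀ {v} → Vec ℕ v → Fin v → ℕ
  _!_ = V.lookup

  track : ∀ {v} → Fin v → List (Vec ℕ v) → List ℕ
  track i = map (_! i)

  record Encodes {v} (w : List (Vec ℕ v)) (ns : Vec ℕ v) : Set where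
    constructor encodes
    field tracks : ∀ i → IsPaddedRep S (track i w) (ns ! i)

  open Encodes public

  Recognises : ∀ {v} → Automaton (Vec ℕ v) → (Vec ℕ v → Set) → Set
  Recognises A R = ∀ {w ns} → Encodes w ns → Accepts A w ⇔ R ns

  record Automatic (v : ℕ) (R : Vec ℕ v → Set) : Set₁ where
    field
      automaton  : Automaton (Vec ℕ v)
      recognises : Recognises automaton R

  open Automatic public

  ⇔-automatic : ∀ {v R R′} → Automatic v R → (∀ {ns} → R ns ⇔ R′ ns) → Automatic v R′
  ⇔-automatic ℛ R⇔R′ = record { automaton = automaton ℛ ; recognises = λ enc → ⇔.trans (recognises ℛ enc) R⇔R′ }

  ∧-automatic : ∀ {v R R′} → Automatic v R → Automatic v R′ → Automatic v (λ ns → R ns × R′ ns)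
  ∧-automatic ℛ 𝒮 = record
    { automaton  = automaton ℛ ∩ᴬ automaton 𝒮
    ; recognises = λ {w} enc → ⇔.trans (Accepts-∩ (automaton ℛ) (automaton 𝒮) w) (recognises ℛ enc ×-⇔ recognises 𝒮 enc) }

  ¬-automatic : ∀ {v R} → Automatic v R → Automatic v (λ ns → ¬ R ns)
  ¬-automatic ℛ = record
    { automaton  = complementᴬ (automaton ℛ)
    ; recognises = λ {w} enc → ⇔.trans (Accepts-complement (automaton ℛ) w) (¬-⇔ (recognises ℛ enc)) }
    where
      ¬-⇔ : ∀ {A B : Set} → A ⇔ B → (¬ A) ⇔ (¬ B)
      ¬-⇔ A⇔B = mk⇔ (λ ¬a b → ¬a (from A⇔B b)) (λ ¬b a → ¬b (to A⇔B a))

  reindex : ∀ {v v′} → Vec (Fin v′) v → Vec ℕ v′ → Vec ℕ v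
  reindex f ns = V.map (ns !_) f

  reindex-automatic : ∀ {v v′ R} (f : Vec (Fin v′) v) → Automatic v R → Automatic v′ (λ ns → R (reindex f ns))
  reindex-automatic f ℛ = record
    { automaton  = comap (reindex f) (automaton ℛ)
    ; recognises = λ {w} enc → ⇔.trans (Accepts-comap (reindex f) (automaton ℛ) w) (recognises ℛ (reindex-Encodes enc)) }
    where
      reindex-Encodes : ∀ {w ns} → Encodes w ns → Encodes (map (reindex f) w) (reindex f ns)
      reindex-Encodes {w} {ns} enc = encodes λ i →
        subst₂ (IsPaddedRep S) (trans (map-cong (λ a → sym (V.lookup-map i (a !_) f)) w) (map-∘ w))
                               (sym (V.lookup-map i (ns !_) f)) (tracks enc (V.lookup f i))

  adding : ∀ {v} → (Vec ℕ v → ℕ × ℕ × ℕ) → Automaton (Vec ℕ v)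
  adding g = comap g (fromDFA adder)

  Adds : List ℕ → List ℕ → List ℕ → Set
  Adds u₁ u₂ u₃ = Σ ℕ λ a → Σ ℕ λ b → Σ ℕ λ c →
    IsPaddedRep S u₁ a × IsPaddedRep S u₂ b × IsPaddedRep S u₃ c × a + b ≡ c

  Accepts-adding : ∀ {v} (g : Vec ℕ v → ℕ × ℕ × ℕ) w →
    Accepts (adding g) w ⇔ Adds (map (proj₁ ∘ g) w) (map (proj₁ ∘ proj₂ ∘ g) w) (map (proj₂ ∘ proj₂ ∘ g) w)
  Accepts-adding g w
    rewrite map-∘ {g = proj₁} {f = g} w | map-∘ {g = proj₁ ∘ proj₂} {f = g} w | map-∘ {g = proj₂ ∘ proj₂} {f = g} w =
    ⇔.trans (Accepts-comap g (fromDFA adder) w) (⇔.trans (Accepts-fromDFA adder (map g w)) (adder-correct (map g w)))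

  +-automatic : Automatic 3 (λ ns → ns ! # 0 + ns ! # 1 ≡ ns ! # 2)
  +-automatic = record
    { automaton  = adding triple
    ; recognises = λ {w} enc → ⇔.trans (Accepts-adding triple w) (mk⇔ (sound enc) (complete enc)) }
    where
      triple : Vec ℕ 3 → ℕ × ℕ × ℕ
      triple ns = ns ! # 0 , ns ! # 1 , ns ! # 2
      sound : ∀ {w ns} → Encodes w ns → Adds (track (# 0) w) (track (# 1) w) (track (# 2) w) → ns ! # 0 + ns ! # 1 ≡ ns ! # 2
      sound enc (a , b , c , pa , pb , pc , a+b≡c) =
        subst₂ _≡_ (cong₂ _+_ (padded-injective pa (tracks enc _)) (padded-injective pb (tracks enc _)))
                   (padded-injective pc (tracks enc _)) a+b≡c
      complete : ∀ {w ns} → Encodes w ns → ns ! # 0 + ns ! # 1 ≡ ns ! # 2 → Adds (track (# 0) w) (track (# 1) w) (track (# 2) w)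
      complete enc sum≡ = _ , _ , _ , tracks enc _ , tracks enc _ , tracks enc _ , sum≡

  -- n + 0 = n: the adder accepts exactly when track i is some padded representation
  number : ∀ {v} → Fin v → Automaton (Vec ℕ v)
  number i = adding (λ a → a ! i , 0 , a ! i)

  Accepts-number⁻ : ∀ {v} (i : Fin v) w → Accepts (number i) w → ∃[ n ] IsPaddedRep S (track i w) n
  Accepts-number⁻ i w acc with to (Accepts-adding _ w) acc
  ... | n , _ , _ , pn , _ = n , pn

  Accepts-number⁺ : ∀ {v} (i : Fin v) w {n} → IsPaddedRep S (track i w) n → Accepts (number i) w
  Accepts-number⁺ i w pn = from (Accepts-adding _ w) (_ , 0 , _ , pn , zeros , pn , +-identityʳ _)
    where
      map-const0 : ∀ {X : Set} (xs : List X) → map (λ _ → 0) xs ≡ replicate (length xs) 0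
      map-const0 []       = refl
      map-const0 (_ ∷ xs) = cong (0 ∷_) (map-const0 xs)
      zeros : IsPaddedRep S (map (λ _ → 0) w) 0
      zeros = subst (λ z → IsPaddedRep S z 0) (sym (map-const0 w)) (zeros-isPadded (length w))

  lift : ∀ {v} → ℕ → Vec ℕ (suc v)
  lift d = d ∷ᵛ V.replicate _ 0

  zipTracks : ∀ {v} → List ℕ → List (Vec ℕ v) → List (Vec ℕ (suc v))
  zipTracks = zipWith _∷ᵛ_

  liftedStep : ∀ {v} (B : Automaton (Vec ℕ (suc v))) → Automaton.State B → ℕ → Automaton.State B
  liftedStep B q d = Automaton.step B q (lift d)

  run-lifted++ : ∀ {v} (B : Automaton (Vec ℕ (suc v))) q u Z →
    Automaton.run B q (map lift u ++ Z) ≡ Automaton.run B (foldl (liftedStep B) q u) Z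
  run-lifted++ B q u Z = trans (foldl-++ step q (map lift u) Z) (cong (λ p → run p Z) (foldl-map step lift q u))
    where open Automaton B

  -- Subset construction guessing the digits of track 0. The number on track 0 may be longer
  -- than w; its excess leading digits u are absorbed into the initial subset, which holds the
  -- states reached by `map lift u`.
  module Projection {v} (B : Automaton (Vec ℕ (suc v))) where
    open Automaton B hiding (Accepts)
    open Finite finite

    Subset : Set
    Subset = Vec Bool size

    _∈ₛ_ : State → Subset → Set
    q ∈ₛ X = T (V.lookup X (index q))

    _∈ₛ?_ : ∀ q X → Dec (q ∈ₛ X)
    q ∈ₛ? X = T? _

    ⟦_⟧ : {P : State → Set} → Decidable P → Subset
    ⟦ P? ⟧ = V.tabulate (λ k → isYes (P? (element k)))

    ∈-⟦⟧ : ∀ {P} (P? : Decidable P) q → q ∈ₛ ⟦ P? ⟧ ⇔ P q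
    ∈-⟦⟧ P? q rewrite V.lookup∘tabulate (λ k → isYes (P? (element k))) (index q) | element-index q =
      mk⇔ toWitness fromWitness

    IsSuccessor : Subset → Vec ℕ v → State → Set
    IsSuccessor X a q = Any (λ p → p ∈ₛ X × Any (λ d → step p (d ∷ᵛ a) ≡ q) (upTo β)) elements

    isSuccessor? : ∀ X a → Decidable (IsSuccessor X a)
    isSuccessor? X a q = Any.any? (λ p → (p ∈ₛ? X) ×-dec Any.any? (λ d → step p (d ∷ᵛ a) ≟ q) (upTo β)) elements

    successors : Subset → Vec ℕ v → Subset
    successors X a = ⟦ isSuccessor? X a ⟧

    ∈-successors : ∀ X a q → q ∈ₛ successors X a ⇔ (∃ λ p → ∃ λ d → p ∈ₛ X × d < β × step p (d ∷ᵛ a) ≡ q)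
    ∈-successors X a q = ⇔.trans (∈-⟦⟧ (isSuccessor? X a) q) (mk⇔ ⇒ ⇐)
      where
        ⇒ : IsSuccessor X a q → ∃ λ p → ∃ λ d → p ∈ₛ X × d < β × step p (d ∷ᵛ a) ≡ q
        ⇒ any with Any.satisfied any
        ... | p , p∈X , any-d with find any-d
        ...   | d , d∈ , step≡ = p , d , p∈X , ∈-upTo⁻ d∈ , step≡
        ⇐ : (∃ λ p → ∃ λ d → p ∈ₛ X × d < β × step p (d ∷ᵛ a) ≡ q) → IsSuccessor X a q
        ⇐ (p , d , p∈X , d<β , step≡) = lose (complete p) (p∈X , lose (∈-upTo⁺ d<β) step≡)

    IsReached : State → Set
    IsReached q = Any (λ k → Any (λ u → run start (map lift u) ≡ q) (allWords (upTo β) k)) (upTo (suc size))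

    isReached? : Decidable IsReached
    isReached? q = Any.any? (λ k → Any.any? (λ u → run start (map lift u) ≟ q) (allWords (upTo β) k)) (upTo (suc size))

    initial : Subset
    initial = ⟦ isReached? ⟧

    ∈-initial : ∀ q → q ∈ₛ initial ⇔ (∃ λ u → length u ≤ size × All (_< β) u × run start (map lift u) ≡ q)
    ∈-initial q = ⇔.trans (∈-⟦⟧ isReached? q) (mk⇔ ⇒ ⇐)
      where
        ⇒ : IsReached q → ∃ λ u → length u ≤ size × All (_< β) u × run start (map lift u) ≡ q
        ⇒ any with find any
        ... | k , k∈ , any-u with find any-u
        ...   | u , u∈ , run≡ with ∈-allWords⁻ (upTo β) k u∈
        ...     | refl , u∈digits = u , ≤-pred (∈-upTo⁻ k∈) , All.map ∈-upTo⁻ u∈digits , run≡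
        ⇐ : (∃ λ u → length u ≤ size × All (_< β) u × run start (map lift u) ≡ q) → IsReached q
        ⇐ (u , |u|≤size , u<β , run≡) = lose (∈-upTo⁺ (s≤s |u|≤size)) (lose (∈-allWords⁺ (All.map ∈-upTo⁺ u<β)) run≡)

    acceptingₛ : Subset → Bool
    acceptingₛ X = isYes (Any.any? (λ p → (p ∈ₛ? X) ×-dec T? (accepting p)) elements)

    T-acceptingₛ : ∀ X → T (acceptingₛ X) ⇔ (∃ λ q → q ∈ₛ X × T (accepting q))
    T-acceptingₛ X = mk⇔ (Any.satisfied ∘ toWitness) (λ (q , q∈X , acc) → fromWitness (lose (complete q) (q∈X , acc)))

    runₛ-sound : ∀ w X q → q ∈ₛ foldl successors X w →
      ∃ λ p → ∃ λ e → p ∈ₛ X × length e ≡ length w × run p (zipTracks e w) ≡ q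
    runₛ-sound []      X q q∈ = q , [] , q∈ , refl , refl
    runₛ-sound (a ∷ w) X q q∈ with runₛ-sound w (successors X a) q q∈
    ... | p′ , e , p′∈ , |e|≡ , run≡ with to (∈-successors X a p′) p′∈
    ...   | p , d , p∈X , _ , step≡ = p , d ∷ e , p∈X , cong suc |e|≡ , trans (cong (λ r → run r (zipTracks e w)) step≡) run≡

    runₛ-complete : ∀ w X {p e} → p ∈ₛ X → All (_< β) e → length e ≡ length w → run p (zipTracks e w) ∈ₛ foldl successors X w
    runₛ-complete []      X {e = []}    p∈ []          _    = p∈
    runₛ-complete (a ∷ w) X {p} {d ∷ e} p∈ (d<β ∷ e<β) |e|≡ =
      runₛ-complete w (successors X a) (from (∈-successors X a _) (p , d , p∈ , d<β , refl)) e<β (suc-injective |e|≡)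

    projection : Automaton (Vec ℕ v)
    projection = record
      { State = Subset ; start = initial ; step = successors ; accepting = acceptingₛ ; finite = BoolVec-finite size }

    Accepts-projection⁻ : ∀ w → Accepts projection w →
      ∃ λ u → ∃ λ e → length e ≡ length w × Accepts B (map lift u ++ zipTracks e w)
    Accepts-projection⁻ w acc =
      let q , q∈ , q-accepting     = to (T-acceptingₛ (foldl successors initial w)) acc
          p , e , p∈ , |e|≡ , run≡ = runₛ-sound w initial q q∈
          u , _ , _ , run-u≡        = to (∈-initial p) p∈
          W-run = trans (foldl-++ step start (map lift u) (zipTracks e w)) (trans (cong (λ r → run r (zipTracks e w)) run-u≡) run≡)
      in u , e , |e|≡ , subst (T ∘ accepting) (sym W-run) q-accepting

    -- the prefix u may be arbitrarily long; a pigeonhole shortening makes it fit the initial subset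
    Accepts-projection⁺ : ∀ w {u e} → All (_< β) u → All (_< β) e → length e ≡ length w →
      Accepts B (map lift u ++ zipTracks e w) → Accepts projection w
    Accepts-projection⁺ w {u} {e} u<β e<β |e|≡ acc with run-shorten finite (liftedStep B) start u u<β
    ... | u′ , |u′|≤size , u′<β , same =
      from (T-acceptingₛ (foldl successors initial w)) (_ , runₛ-complete w initial p∈ e<β |e|≡ , acc′)
      where
        p∈ : foldl (liftedStep B) start u′ ∈ₛ initial
        p∈ = from (∈-initial (foldl (liftedStep B) start u′)) (u′ , |u′|≤size , u′<β , foldl-map step lift start u′)
        acc′ : T (accepting (run (foldl (liftedStep B) start u′) (zipTracks e w)))
        acc′ = subst (λ q → T (accepting (run q (zipTracks e w)))) (sym same)
                     (subst (T ∘ accepting) (run-lifted++ B start u (zipTracks e w)) acc)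

  private
    track-lifts-zero : ∀ {v} u → track fzero (map (lift {v}) u) ≡ u
    track-lifts-zero []      = refl
    track-lifts-zero (d ∷ u) = cong (d ∷_) (track-lifts-zero u)

    track-lifts-suc : ∀ {v} (i : Fin v) u → track (fsuc i) (map lift u) ≡ replicate (length u) 0
    track-lifts-suc i []      = refl
    track-lifts-suc i (d ∷ u) = cong₂ _∷_ (V.lookup-replicate i 0) (track-lifts-suc i u)

    track-zip-zero : ∀ {v} e (w : List (Vec ℕ v)) → length e ≡ length w → track fzero (zipTracks e w) ≡ e
    track-zip-zero []      []      _    = refl
    track-zip-zero (d ∷ e) (a ∷ w) |e|≡ = cong (d ∷_) (track-zip-zero e w (suc-injective |e|≡))

    track-zip-suc : ∀ {v} (i : Fin v) e w → length e ≡ length w → track (fsuc i) (zipTracks e w) ≡ track i w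
    track-zip-suc i []      []      _    = refl
    track-zip-suc i (d ∷ e) (a ∷ w) |e|≡ = cong (a ! i ∷_) (track-zip-suc i e w (suc-injective |e|≡))

  track-extend-zero : ∀ {v} u e (w : List (Vec ℕ v)) → length e ≡ length w → track fzero (map lift u ++ zipTracks e w) ≡ u ++ e
  track-extend-zero u e w |e|≡ = trans (map-++ _ (map lift u) (zipTracks e w)) (cong₂ _++_ (track-lifts-zero u) (track-zip-zero e w |e|≡))

  Encodes-extend : ∀ {v} {w : List (Vec ℕ v)} {ns} u e {j} → length e ≡ length w → Encodes w ns →
    IsPaddedRep S (u ++ e) j → Encodes (map lift u ++ zipTracks e w) (j ∷ᵛ ns)
  Encodes-extend {w = w} {ns} u e {j} |e|≡ enc pj = encodes λ where
    fzero    → subst (λ z → IsPaddedRep S z j) (sym (track-extend-zero u e w |e|≡)) pj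
    (fsuc i) → subst (λ z → IsPaddedRep S z (ns ! i))
                 (sym (trans (map-++ _ (map lift u) (zipTracks e w)) (cong₂ _++_ (track-lifts-suc i u) (track-zip-suc i e w |e|≡))))
                 (zeros++-isPadded (length u) (tracks enc i))

  extension : ∀ {v} {w : List (Vec ℕ v)} {ns} j → Encodes w ns →
    ∃ λ u → ∃ λ e → All (_< β) u × All (_< β) e × length e ≡ length w × Encodes (map lift u ++ zipTracks e w) (j ∷ᵛ ns)
  extension {w = w} j enc =
    take L t , drop L t , Allₚ.take⁺ L t<β , Allₚ.drop⁺ L t<β , |e|≡ , Encodes-extend (take L t) (drop L t) |e|≡ enc pt
    where
      L = length (rep S j)
      t = replicate (length w) 0 ++ rep S j
      t<β : All (_< β) t
      t<β = Allₚ.++⁺ (Allₚ.replicate⁺ (length w) (alphabet-nonempty digits<β)) (digits<β j)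
      |e|≡ : length (drop L t) ≡ length w
      |e|≡ = trans (length-drop L t) (trans (cong (_∸ L) (length-replicate++ (length w) (rep S j))) (m+n∸n≡m (length w) L))
      pt : IsPaddedRep S (take L t ++ drop L t) j
      pt = subst (λ z → IsPaddedRep S z j) (sym (take++drop≡id L t)) (zeros++-isPadded (length w) (rep-isPadded j))

  ∃-automatic : ∀ {v R} → Automatic (suc v) R → Automatic v (λ ns → ∃[ j ] R (j ∷ᵛ ns))
  ∃-automatic {v} {R} ℛ = record { automaton = projection ; recognises = λ {w} enc → mk⇔ (sound w enc) (complete w enc) }
    where
      -- the conjunct `number fzero` makes the guessed track a padded representation
      open Projection (automaton ℛ ∩ᴬ number fzero)
      sound : ∀ w {ns} → Encodes w ns → Accepts projection w → ∃[ j ] R (j ∷ᵛ ns)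
      sound w enc acc =
        let u , e , |e|≡ , acc-∩ = Accepts-projection⁻ w acc
            W = map lift u ++ zipTracks e w
            acc-R , acc-number = to (Accepts-∩ (automaton ℛ) (number fzero) W) acc-∩
            j , pj = Accepts-number⁻ fzero W acc-number
        in j , to (recognises ℛ (Encodes-extend u e |e|≡ enc (subst (λ z → IsPaddedRep S z j) (track-extend-zero u e w |e|≡) pj))) acc-R
      complete : ∀ w {ns} → Encodes w ns → ∃[ j ] R (j ∷ᵛ ns) → Accepts projection w
      complete w {ns} enc (j , r) = accepted (extension j enc)
        where
          accepted : (∃ λ u → ∃ λ e → All (_< β) u × All (_< β) e × length e ≡ length w ×
                       Encodes (map lift u ++ zipTracks e w) (j ∷ᵛ ns)) → Accepts projection w
          accepted (u , e , u<β , e<β , |e|≡ , enc′) = Accepts-projection⁺ w u<β e<β |e|≡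
            (from (Accepts-∩ (automaton ℛ) (number fzero) (map lift u ++ zipTracks e w))
                  (from (recognises ℛ enc′) r , Accepts-number⁺ fzero (map lift u ++ zipTracks e w) (tracks enc′ fzero)))

-- Factors up to reversal

module _ {A : Set} where

  Unique⇒length≤ : ∀ {xs ys : List A} → Unique xs → All (_∈ ys) xs → length xs ≤ length ys
  Unique⇒length≤ {[]}     _            _              = z≤n
  Unique⇒length≤ {a ∷ xs} (a∉xs ∷ xs!) (a∈ys ∷ xs⊆ys) with ∈-∃++ a∈ys
  ... | ys₁ , ys₂ , refl = begin
    suc (length xs)                ≤⟨ s≤s (Unique⇒length≤ xs! (All.zipWith remove (a∉xs , xs⊆ys))) ⟩
    suc (length (ys₁ ++ ys₂))      ≡⟨ cong suc (length-++ ys₁) ⟩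
    suc (length ys₁ + length ys₂)  ≡⟨ +-suc (length ys₁) (length ys₂) ⟨
    length ys₁ + length (a ∷ ys₂)  ≡⟨ length-++ ys₁ ⟨
    length (ys₁ ++ a ∷ ys₂)        ∎
    where
      open ≤-Reasoning
      remove : ∀ {b} → a ≢ b × b ∈ ys₁ ++ a ∷ ys₂ → b ∈ ys₁ ++ ys₂
      remove (a≢b , b∈) with ∈-++⁻ ys₁ b∈
      ... | inj₁ b∈ys₁         = ∈-++⁺ˡ b∈ys₁
      ... | inj₂ (here refl)   = ⊥-elim (a≢b refl)
      ... | inj₂ (there b∈ys₂) = ∈-++⁺ʳ ys₁ b∈ys₂

  AllPairs-map-All : ∀ {R R′ : A → A → Set} {P : A → Set} → (∀ {a b} → P a → P b → R a b → R′ a b) →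
    ∀ {xs} → AllPairs R xs → All P xs → AllPairs R′ xs
  AllPairs-map-All f []         []         = []
  AllPairs-map-All f (Rx ∷ Rxs) (Px ∷ Pxs) = All.zipWith (λ (Rxy , Py) → f Px Py Rxy) (Rx , Pxs) ∷ AllPairs-map-All f Rxs Pxs

search< : {P : ℕ → Set} → Decidable P → ∀ n →
  (∃ λ j → j < n × P j × (∀ {k} → k < j → ¬ P k)) ⊎ (∀ {k} → k < n → ¬ P k)
search< P? zero = inj₂ λ ()
search< P? (suc n) with search< P? n
... | inj₁ (j , j<n , Pj , least) = inj₁ (j , m≤n⇒m≤1+n j<n , Pj , least)
... | inj₂ none with P? n
...   | yes Pn = inj₁ (n , ≤-refl , Pn , none)
...   | no ¬Pn = inj₂ λ k<1+n → case m≤n⇒m<n∨m≡n (≤-pred k<1+n) of λ where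
          (inj₁ k<n)  → none k<n
          (inj₂ refl) → ¬Pn

least-witness : {P : ℕ → Set} → Decidable P → ∀ {i} → P i → ∃ λ j → P j × (∀ {k} → k < j → ¬ P k)
least-witness P? {i} Pi with search< P? (suc i)
... | inj₁ (j , _ , Pj , least) = j , Pj , least
... | inj₂ none                 = ⊥-elim (none ≤-refl Pi)

module FactorEquivalence {Δ : Set} (_≟ᵈ_ : DecidableEquality Δ) (x : ℕ → Δ) where

  _≈_ : List Δ → List Δ → Set
  _≈_ = _∼_ x

  ≈-refl : ∀ {u} → u ≈ u
  ≈-refl = inj₁ refl

  ≈-sym : ∀ {u v} → u ≈ v → v ≈ u
  ≈-sym         (inj₁ v≡u)  = inj₁ (sym v≡u)
  ≈-sym {u} {v} (inj₂ v≡uᴿ) = inj₂ (trans (sym (reverse-involutive u)) (cong reverse (sym v≡uᴿ)))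

  ≈-trans : ∀ {u v w} → u ≈ v → v ≈ w → u ≈ w
  ≈-trans     (inj₁ v≡u)  (inj₁ w≡v)  = inj₁ (trans w≡v v≡u)
  ≈-trans     (inj₁ v≡u)  (inj₂ w≡vᴿ) = inj₂ (trans w≡vᴿ (cong reverse v≡u))
  ≈-trans     (inj₂ v≡uᴿ) (inj₁ w≡v)  = inj₂ (trans w≡v v≡uᴿ)
  ≈-trans {u} (inj₂ v≡uᴿ) (inj₂ w≡vᴿ) = inj₁ (trans w≡vᴿ (trans (cong reverse v≡uᴿ) (reverse-involutive u)))

  _≈?_ : ∀ u v → Dec (u ≈ v)
  u ≈? v = ≡-dec _≟ᵈ_ v u ⊎-dec ≡-dec _≟ᵈ_ v (reverse u)

  SameFactor : ℕ → ℕ → ℕ → Set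
  SameFactor n i j = ∀ t → t < n → x (i + t) ≡ x (j + t)

  -- t and s run over complementary positions: t + s = n - 1
  ReversedFactor : ℕ → ℕ → ℕ → Set
  ReversedFactor n i j = ∀ t s → suc (t + s) ≡ n → x (i + t) ≡ x (j + s)

  private
    factor-suc : ∀ i n → factor x i (suc n) ≡ x i ∷ factor x (suc i) n
    factor-suc i n = cong₂ _∷_ (cong x (+-identityʳ i)) (begin
      map (λ t → x (i + t)) (applyUpTo suc n)   ≡⟨ map-applyUpTo suc (λ t → x (i + t)) n ⟩
      applyUpTo (λ t → x (i + suc t)) n          ≡⟨ map-upTo (λ t → x (i + suc t)) n ⟨
      map (λ t → x (i + suc t)) (upTo n)         ≡⟨ map-cong (λ t → cong x (+-suc i t)) (upTo n) ⟩
      factor x (suc i) n                         ∎)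
      where open ≡-Reasoning

    factor-∷ʳ : ∀ i n → factor x i (suc n) ≡ factor x i n ∷ʳ x (i + n)
    factor-∷ʳ i n = trans (cong (map (λ t → x (i + t))) (sym (upTo-∷ʳ n))) (map-++ _ (upTo n) (n ∷ []))

    reverse-factor-suc : ∀ j n → reverse (factor x j (suc n)) ≡ x (j + n) ∷ reverse (factor x j n)
    reverse-factor-suc j n = trans (cong reverse (factor-∷ʳ j n)) (reverse-++ (factor x j n) (x (j + n) ∷ []))

  factor≡⇒SameFactor : ∀ n i j → factor x i n ≡ factor x j n → SameFactor n i j
  factor≡⇒SameFactor (suc n) i j eq t t<1+n
    with ∷ʳ-injective (factor x i n) (factor x j n) (subst₂ _≡_ (factor-∷ʳ i n) (factor-∷ʳ j n) eq)
  ... | init≡ , last≡ with m≤n⇒m<n∨m≡n (≤-pred t<1+n)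
  ...   | inj₁ t<n  = factor≡⇒SameFactor n i j init≡ t t<n
  ...   | inj₂ refl = last≡

  SameFactor⇒factor≡ : ∀ n i j → SameFactor n i j → factor x i n ≡ factor x j n
  SameFactor⇒factor≡ n i j same = map-cong-local (All.tabulate λ t∈ → same _ (∈-upTo⁻ t∈))

  factor≡reverse⇒ReversedFactor : ∀ n i j → factor x i n ≡ reverse (factor x j n) → ReversedFactor n i j
  factor≡reverse⇒ReversedFactor (suc n) i j eq t s t+s≡n with ∷-injective (subst₂ _≡_ (factor-suc i n) (reverse-factor-suc j n) eq)
  factor≡reverse⇒ReversedFactor (suc n) i j eq zero    s 1+s≡1+n | head≡ , _ =
    trans (cong x (+-identityʳ i)) (trans head≡ (cong (λ k → x (j + k)) (sym (suc-injective 1+s≡1+n))))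
  factor≡reverse⇒ReversedFactor (suc n) i j eq (suc t) s t+s≡n | _ , tail≡ =
    trans (cong x (+-suc i t)) (factor≡reverse⇒ReversedFactor n (suc i) j tail≡ t s (suc-injective t+s≡n))

  ReversedFactor⇒factor≡reverse : ∀ n i j → ReversedFactor n i j → factor x i n ≡ reverse (factor x j n)
  ReversedFactor⇒factor≡reverse zero    i j rev = refl
  ReversedFactor⇒factor≡reverse (suc n) i j rev = begin
    factor x i (suc n)                   ≡⟨ factor-suc i n ⟩
    x i ∷ factor x (suc i) n
      ≡⟨ cong₂ _∷_ (trans (cong x (sym (+-identityʳ i))) (rev 0 n refl)) (ReversedFactor⇒factor≡reverse n (suc i) j rev′) ⟩
    x (j + n) ∷ reverse (factor x j n)   ≡⟨ reverse-factor-suc j n ⟨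
    reverse (factor x j (suc n))         ∎
    where
      open ≡-Reasoning
      rev′ : ReversedFactor n (suc i) j
      rev′ t s t+s≡n = trans (cong x (sym (+-suc i t))) (rev (suc t) s (cong suc t+s≡n))

  factor≈⇔ : ∀ n i j → factor x i n ≈ factor x j n ⇔ (SameFactor n j i ⊎ ReversedFactor n j i)
  factor≈⇔ n i j = mk⇔
    [ inj₁ ∘ factor≡⇒SameFactor n j i , inj₂ ∘ factor≡reverse⇒ReversedFactor n j i ]′
    [ inj₁ ∘ SameFactor⇒factor≡ n j i , inj₂ ∘ ReversedFactor⇒factor≡reverse n j i ]′

  FirstOccurrence : ℕ → ℕ → Set
  FirstOccurrence n i = ∀ j → j < i → ¬ (factor x j n ≈ factor x i n)

  firstOccurrence? : ∀ n → Decidable (FirstOccurrence n)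
  firstOccurrence? n i with search< (λ j → factor x j n ≈? factor x i n) i
  ... | inj₁ (j , j<i , j≈i , _) = no λ first → first j j<i j≈i
  ... | inj₂ none                 = yes λ j j<i → none j<i

  earliest-equivalent : ∀ n i → ∃ λ j → FirstOccurrence n j × factor x j n ≈ factor x i n
  earliest-equivalent n i with least-witness (λ j → factor x j n ≈? factor x i n) ≈-refl
  ... | j , j≈i , least = j , (λ k k<j k≈j → least k<j (≈-trans k≈j j≈i)) , j≈i

  firstOccurrences-inequivalent : ∀ {n i j} → FirstOccurrence n i → FirstOccurrence n j → i ≢ j → ¬ (factor x i n ≈ factor x j n)
  firstOccurrences-inequivalent {n} {i} {j} first-i first-j i≢j i≈j with <-cmp i j
  ... | tri< i<j _ _ = first-j i i<j i≈j
  ... | tri≈ _ i≡j _ = i≢j i≡j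
  ... | tri> _ _ j<i = first-i j j<i (≈-sym i≈j)

  firstOccurrences-few : (F : Finite Δ) → ∀ n {js} → Unique js → All (FirstOccurrence n) js →
    length js ≤ length (allWords (Finite.elements F) n)
  firstOccurrences-few F n {js} js! first = begin
    length js                           ≡⟨ length-map (λ j → factor x j n) js ⟨
    length (map (λ j → factor x j n) js) ≤⟨ Unique⇒length≤ factors! factors∈ ⟩
    length (allWords (Finite.elements F) n) ∎
    where
      open ≤-Reasoning
      factors! : Unique (map (λ j → factor x j n) js)
      factors! = AllPairsₚ.map⁺ (AllPairs-map-All
        (λ first-i first-j i≢j same → firstOccurrences-inequivalent first-i first-j i≢j (inj₁ (sym same))) js! first)
      length-factor : ∀ j → length (factor x j n) ≡ n
      length-factor j = trans (length-map _ (upTo n)) (length-upTo n)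
      factors∈ : All (_∈ allWords (Finite.elements F) n) (map (λ j → factor x j n) js)
      factors∈ = Allₚ.map⁺ (All.universal (λ j → subst (λ k → factor x j n ∈ allWords _ k) (length-factor j)
                                                        (∈-allWords⁺ (All.universal (Finite.complete F) _))) js)

module AutomaticFactorRelations (S : NumSys) (β : ℕ) (digits<β : ∀ n → All (_< β) (rep S n))
         (adder : DFA (ℕ × ℕ × ℕ)) (adder-correct : ∀ w → DFA.Accepts adder w ⇔ AddLanguage S w)
         {m} (x : ℕ → Fin m) (X : DFAO ℕ (Fin m)) (x≡ : ∀ n → x n ≡ DFAO.output X (rep S n)) where
  open Representation S
  open AutomaticRelations S β digits<β adder adder-correct
  open FactorEquivalence Fin._≟_ x
  open Equivalence
  module X = DFAO X

  private
    -- `nothing` is the start state of X before the first nonzero digit: leading zeros are skipped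
    step₀ : Maybe (Fin X.nStates) → ℕ → Maybe (Fin X.nStates)
    step₀ nothing  zero    = nothing
    step₀ nothing  (suc d) = just (X.δ X.start (suc d))
    step₀ (just q) d       = just (X.δ q d)

    out₀ : Maybe (Fin X.nStates) → Fin m
    out₀ nothing  = X.τ X.start
    out₀ (just q) = X.τ q

    run₀-just : ∀ q w → foldl step₀ (just q) w ≡ just (X.run q w)
    run₀-just q []      = refl
    run₀-just q (d ∷ w) = run₀-just (X.δ q d) w

    run₀-zeros : ∀ k w → foldl step₀ nothing (replicate k 0 ++ w) ≡ foldl step₀ nothing w
    run₀-zeros zero    w = refl
    run₀-zeros (suc k) w = run₀-zeros k w

    out₀-rep : ∀ n → out₀ (foldl step₀ nothing (rep S n)) ≡ x n
    out₀-rep n with rep S n in rep≡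
    ... | []        = sym (trans (x≡ n) (cong X.output rep≡))
    ... | zero  ∷ w = ⊥-elim (rep-leading≢0 n rep≡ refl)
    ... | suc d ∷ w = trans (cong out₀ (run₀-just (X.δ X.start (suc d)) w)) (sym (trans (x≡ n) (cong X.output rep≡)))

    out₀-padded : ∀ {w n} → IsPaddedRep S w n → out₀ (foldl step₀ nothing w) ≡ x n
    out₀-padded {n = n} (k , refl) = trans (cong out₀ (run₀-zeros k (rep S n))) (out₀-rep n)

  sameLetter-automatic : Automatic 2 (λ ns → x (ns ! # 0) ≡ x (ns ! # 1))
  sameLetter-automatic = record { automaton = sameLetter ; recognises = λ {w} enc → recognises′ w enc }
    where
      sameLetter : Automaton (Vec ℕ 2)
      sameLetter = record
        { State     = Maybe (Fin X.nStates) × Maybe (Fin X.nStates)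
        ; start     = nothing , nothing
        ; step      = λ (p , q) a → step₀ p (a ! # 0) , step₀ q (a ! # 1)
        ; accepting = λ (p , q) → isYes (out₀ p Fin.≟ out₀ q)
        ; finite    = ×-finite (Maybe-finite (Fin-finite _)) (Maybe-finite (Fin-finite _)) }
      run-tracks : ∀ p q w → Automaton.run sameLetter (p , q) w ≡ (foldl step₀ p (track (# 0) w) , foldl step₀ q (track (# 1) w))
      run-tracks p q []      = refl
      run-tracks p q (a ∷ w) = run-tracks _ _ w
      recognises′ : ∀ w {ns} → Encodes w ns → Accepts sameLetter w ⇔ (x (ns ! # 0) ≡ x (ns ! # 1))
      recognises′ w enc rewrite run-tracks nothing nothing w
                              | out₀-padded (tracks enc (# 0)) | out₀-padded (tracks enc (# 1)) = mk⇔ toWitness fromWitness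

  -- ∃ b a. i + t = a ∧ j + t′ = b ∧ x(a) = x(b), on tracks (a, b, i, j, t, t′)
  shiftedLetters-automatic : Automatic 4 (λ ns → x (ns ! # 0 + ns ! # 2) ≡ x (ns ! # 1 + ns ! # 3))
  shiftedLetters-automatic = ⇔-automatic
    (∃-automatic (∃-automatic
      (∧-automatic (reindex-automatic (# 2 ∷ᵛ # 4 ∷ᵛ # 0 ∷ᵛ []ᵛ) +-automatic)
      (∧-automatic (reindex-automatic (# 3 ∷ᵛ # 5 ∷ᵛ # 1 ∷ᵛ []ᵛ) +-automatic)
                   (reindex-automatic (# 0 ∷ᵛ # 1 ∷ᵛ []ᵛ) sameLetter-automatic)))))
    (mk⇔ (λ { (_ , _ , refl , refl , eq) → eq }) (λ eq → _ , _ , refl , refl , eq))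

  -- ∃ c. p + c = q ∧ c + c ≠ c (that is, c ≠ 0), on tracks (c, p, q)
  <-automatic : Automatic 2 (λ ns → ns ! # 0 < ns ! # 1)
  <-automatic = ⇔-automatic
    (∃-automatic (∧-automatic (reindex-automatic (# 1 ∷ᵛ # 0 ∷ᵛ # 2 ∷ᵛ []ᵛ) +-automatic)
                         (¬-automatic (reindex-automatic (# 0 ∷ᵛ # 0 ∷ᵛ # 0 ∷ᵛ []ᵛ) +-automatic))))
    (mk⇔ ⇒ ⇐)
    where
      ⇒ : ∀ {p q} → (∃ λ c → p + c ≡ q × c + c ≢ c) → p < q
      ⇒ (zero  , _     , c+c≢c) = ⊥-elim (c+c≢c refl)
      ⇒ {p} (suc c , p+c≡q , _) = subst (p <_) p+c≡q (m<m+n p (s≤s z≤n))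
      ⇐ : ∀ {p q} → p < q → ∃ λ c → p + c ≡ q × c + c ≢ c
      ⇐ {p} {q} p<q = q ∸ p , m+[n∸m]≡n (<⇒≤ p<q) ,
        λ c+c≡c → <⇒≢ (m<n⇒0<n∸m p<q) (sym (+-cancelˡ-≡ (q ∸ p) _ 0 (trans c+c≡c (sym (+-identityʳ _)))))

  -- p < q ∧ ¬ ∃ r. p < r < q, on tracks (r, p, q)
  suc-automatic : Automatic 2 (λ ns → suc (ns ! # 0) ≡ ns ! # 1)
  suc-automatic = ⇔-automatic
    (∧-automatic <-automatic
      (¬-automatic (∃-automatic (∧-automatic (reindex-automatic (# 1 ∷ᵛ # 0 ∷ᵛ []ᵛ) <-automatic)
                                            (reindex-automatic (# 0 ∷ᵛ # 2 ∷ᵛ []ᵛ) <-automatic)))))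
    (mk⇔ ⇒ ⇐)
    where
      ⇒ : ∀ {p q} → p < q × ¬ (∃ λ r → p < r × r < q) → suc p ≡ q
      ⇒ (p<q , nothing-between) = ≤-antisym p<q (≮⇒≥ λ 1+p<q → nothing-between (_ , ≤-refl , 1+p<q))
      ⇐ : ∀ {p q} → suc p ≡ q → p < q × ¬ (∃ λ r → p < r × r < q)
      ⇐ refl = ≤-refl , λ (r , p<r , r<1+p) → <⇒≱ p<r (≤-pred r<1+p)

  -- ¬ ∃ t. t < n ∧ x(i + t) ≠ x(j + t), on tracks (t, n, i, j)
  SameFactor-automatic : Automatic 3 (λ ns → SameFactor (ns ! # 0) (ns ! # 1) (ns ! # 2))
  SameFactor-automatic = ⇔-automatic
    (¬-automatic (∃-automatic (∧-automatic (reindex-automatic (# 0 ∷ᵛ # 1 ∷ᵛ []ᵛ) <-automatic)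
      (¬-automatic (reindex-automatic (# 2 ∷ᵛ # 3 ∷ᵛ # 0 ∷ᵛ # 0 ∷ᵛ []ᵛ) shiftedLetters-automatic)))))
    (mk⇔ (λ no-mismatch t t<n → decidable-stable (_ Fin.≟ _) λ mismatch → no-mismatch (t , t<n , mismatch))
         (λ same (t , t<n , mismatch) → mismatch (same t t<n)))

  -- ¬ ∃ t s u. t + s = u ∧ suc u = n ∧ x(i + t) ≠ x(j + s), on tracks (u, s, t, n, i, j)
  ReversedFactor-automatic : Automatic 3 (λ ns → ReversedFactor (ns ! # 0) (ns ! # 1) (ns ! # 2))
  ReversedFactor-automatic = ⇔-automatic
    (¬-automatic (∃-automatic (∃-automatic (∃-automatic
      (∧-automatic (reindex-automatic (# 2 ∷ᵛ # 1 ∷ᵛ # 0 ∷ᵛ []ᵛ) +-automatic)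
      (∧-automatic (reindex-automatic (# 0 ∷ᵛ # 3 ∷ᵛ []ᵛ) suc-automatic)
        (¬-automatic (reindex-automatic (# 4 ∷ᵛ # 5 ∷ᵛ # 2 ∷ᵛ # 1 ∷ᵛ []ᵛ) shiftedLetters-automatic))))))))
    (mk⇔ (λ no-mismatch t s 1+t+s≡n → decidable-stable (_ Fin.≟ _) λ mismatch →
            no-mismatch (t , s , t + s , refl , 1+t+s≡n , mismatch))
         (λ { rev (t , s , _ , refl , 1+t+s≡n , mismatch) → mismatch (rev t s 1+t+s≡n) }))

  -- ¬ ∃ j. j < i ∧ ¬ (¬ SameFactor n i j ∧ ¬ ReversedFactor n i j), on tracks (j, n, i)
  FirstOccurrence-automatic : Automatic 2 (λ ns → FirstOccurrence (ns ! # 0) (ns ! # 1))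
  FirstOccurrence-automatic = ⇔-automatic
    (¬-automatic (∃-automatic (∧-automatic (reindex-automatic (# 0 ∷ᵛ # 2 ∷ᵛ []ᵛ) <-automatic)
      (¬-automatic (∧-automatic (¬-automatic (reindex-automatic (# 1 ∷ᵛ # 2 ∷ᵛ # 0 ∷ᵛ []ᵛ) SameFactor-automatic))
                                (¬-automatic (reindex-automatic (# 1 ∷ᵛ # 2 ∷ᵛ # 0 ∷ᵛ []ᵛ) ReversedFactor-automatic)))))))
    (mk⇔ (λ no-earlier j j<i j≈i → no-earlier (j , j<i , λ (¬same , ¬rev) → [ ¬same , ¬rev ]′ (to (factor≈⇔ _ j _) j≈i)))
         (λ first (j , j<i , ¬¬≈) → ¬¬≈ ((λ same → first j j<i (from (factor≈⇔ _ j _) (inj₁ same))) ,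
                                         (λ rev → first j j<i (from (factor≈⇔ _ j _) (inj₂ rev))))))

-- Sums and matrices

module ℕΣ = Algebra.Properties.Semiring.Sum ℕₚ.+-*-semiring
module ℤΣ = Algebra.Properties.Semiring.Sum ℤₚ.+-*-semiring

sumFin≡∑ : ∀ {d} (f : Fin d → ℤ) → sumFin f ≡ ℤΣ.sum f
sumFin≡∑ {zero}  f = refl
sumFin≡∑ {suc d} f = cong (λ s → f fzero ℤ.+ s) (sumFin≡∑ (f ∘ fsuc))

∑-pos : ∀ {d} (f : Fin d → ℕ) → ℤΣ.sum (λ i → + f i) ≡ + ℕΣ.sum f
∑-pos {zero}  f = refl
∑-pos {suc d} f = trans (cong (λ s → + f fzero ℤ.+ s) (∑-pos (f ∘ fsuc))) (sym (ℤₚ.pos-+ (f fzero) (ℕΣ.sum (f ∘ fsuc))))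

∑-indicator : ∀ {d} (i : Fin d) (g : Fin d → ℕ) → ℕΣ.sum (λ k → indicator (does (i Fin.≟ k)) * g k) ≡ g i
∑-indicator {suc d} fzero    g = trans (cong (λ s → g fzero + 0 + s) (ℕΣ.sum-replicate-zero d)) (trans (+-identityʳ _) (+-identityʳ _))
∑-indicator {suc d} (fsuc i) g = ∑-indicator i (g ∘ fsuc)

∑-count : ∀ {A : Set} {d} (h : A → Fin d) (g : Fin d → ℕ) xs →
  ℕΣ.sum (λ k → count (λ a → does (h a Fin.≟ k)) xs * g k) ≡ sum (map (g ∘ h) xs)
∑-count {d = d} h g []       = ℕΣ.sum-replicate-zero d
∑-count         h g (a ∷ xs) = begin
  ℕΣ.sum (λ k → (indicator (does (h a Fin.≟ k)) + count (λ a → does (h a Fin.≟ k)) xs) * g k)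
    ≡⟨ ℕΣ.sum-cong-≗ (λ k → *-distribʳ-+ (g k) (indicator (does (h a Fin.≟ k))) _) ⟩
  ℕΣ.sum (λ k → indicator (does (h a Fin.≟ k)) * g k + count (λ a → does (h a Fin.≟ k)) xs * g k)
    ≡⟨ ℕΣ.∑-distrib-+ (λ k → indicator (does (h a Fin.≟ k)) * g k) _ ⟩
  ℕΣ.sum (λ k → indicator (does (h a Fin.≟ k)) * g k) + ℕΣ.sum (λ k → count (λ a → does (h a Fin.≟ k)) xs * g k)
    ≡⟨ cong₂ _+_ (∑-indicator (h a) g) (∑-count h g xs) ⟩
  g (h a) + sum (map (g ∘ h) xs) ∎
  where open ≡-Reasoning

∑-count-pos : ∀ {A : Set} {d} (h : A → Fin d) (g : Fin d → ℕ) xs →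
  ℤΣ.sum (λ k → + count (λ a → does (h a Fin.≟ k)) xs ℤ.* + g k) ≡ + sum (map (g ∘ h) xs)
∑-count-pos h g xs = begin
  ℤΣ.sum (λ k → + count (λ a → does (h a Fin.≟ k)) xs ℤ.* + g k)
    ≡⟨ ℤΣ.sum-cong-≗ (λ k → sym (ℤₚ.pos-* (count (λ a → does (h a Fin.≟ k)) xs) (g k))) ⟩
  ℤΣ.sum (λ k → + (count (λ a → does (h a Fin.≟ k)) xs * g k))
    ≡⟨ ∑-pos (λ k → count (λ a → does (h a Fin.≟ k)) xs * g k) ⟩
  + ℕΣ.sum (λ k → count (λ a → does (h a Fin.≟ k)) xs * g k)    ≡⟨ cong +_ (∑-count h g xs) ⟩
  + sum (map (g ∘ h) xs) ∎
  where open ≡-Reasoning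

_·_ : ∀ {d} → Mat d → (Fin d → ℤ) → Fin d → ℤ
(M · v) i = ℤΣ.sum (λ k → M i k ℤ.* v k)

⊗-· : ∀ {d} (M N : Mat d) v i → ((M ⊗ N) · v) i ≡ (M · (N · v)) i
⊗-· M N v i = begin
  ℤΣ.sum (λ j → sumFin (λ k → M i k ℤ.* N k j) ℤ.* v j)
    ≡⟨ ℤΣ.sum-cong-≗ (λ j → cong (ℤ._* v j) (sumFin≡∑ (λ k → M i k ℤ.* N k j))) ⟩
  ℤΣ.sum (λ j → ℤΣ.sum (λ k → M i k ℤ.* N k j) ℤ.* v j)
    ≡⟨ ℤΣ.sum-cong-≗ (λ j → ℤΣ.*-distribʳ-sum (v j) (λ k → M i k ℤ.* N k j)) ⟩
  ℤΣ.sum (λ j → ℤΣ.sum (λ k → M i k ℤ.* N k j ℤ.* v j))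
    ≡⟨ ℤΣ.∑-comm (λ j k → M i k ℤ.* N k j ℤ.* v j) ⟩
  ℤΣ.sum (λ k → ℤΣ.sum (λ j → M i k ℤ.* N k j ℤ.* v j))
    ≡⟨ ℤΣ.sum-cong-≗ (λ k → ℤΣ.sum-cong-≗ (λ j → ℤₚ.*-assoc (M i k) (N k j) (v j))) ⟩
  ℤΣ.sum (λ k → ℤΣ.sum (λ j → M i k ℤ.* (N k j ℤ.* v j)))
    ≡⟨ ℤΣ.sum-cong-≗ (λ k → ℤΣ.*-distribˡ-sum (M i k) (λ j → N k j ℤ.* v j)) ⟨
  ℤΣ.sum (λ k → M i k ℤ.* ℤΣ.sum (λ j → N k j ℤ.* v j)) ∎
  where open ≡-Reasoning

idMat-· : ∀ {d} (v : Fin d → ℤ) i → (idMat · v) i ≡ v i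
idMat-· {suc d} v fzero    =
  trans (cong₂ ℤ._+_ (ℤₚ.*-identityˡ (v fzero)) (trans (ℤΣ.sum-cong-≗ (λ k → ℤₚ.*-zeroˡ (v (fsuc k)))) (ℤΣ.sum-replicate-zero d)))
        (ℤₚ.+-identityʳ (v fzero))
idMat-· {suc d} v (fsuc i) = trans (cong₂ ℤ._+_ (ℤₚ.*-zeroˡ (v fzero)) (idMat-· (v ∘ fsuc) i)) (ℤₚ.+-identityˡ _)

evalRep-· : ∀ {d} (λᵥ : Fin d → ℤ) μ γ w → evalRep λᵥ μ γ w ≡ ℤΣ.sum (λ i → λᵥ i ℤ.* (μ* μ w · γ) i)
evalRep-· λᵥ μ γ w = begin
  sumFin (λ i → sumFin (λ j → λᵥ i ℤ.* (μ* μ w i j ℤ.* γ j)))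
    ≡⟨ sumFin≡∑ (λ i → sumFin (λ j → λᵥ i ℤ.* (μ* μ w i j ℤ.* γ j))) ⟩
  ℤΣ.sum (λ i → sumFin (λ j → λᵥ i ℤ.* (μ* μ w i j ℤ.* γ j)))
    ≡⟨ ℤΣ.sum-cong-≗ (λ i → sumFin≡∑ (λ j → λᵥ i ℤ.* (μ* μ w i j ℤ.* γ j))) ⟩
  ℤΣ.sum (λ i → ℤΣ.sum (λ j → λᵥ i ℤ.* (μ* μ w i j ℤ.* γ j)))
    ≡⟨ ℤΣ.sum-cong-≗ (λ i → ℤΣ.*-distribˡ-sum (λᵥ i) (λ j → μ* μ w i j ℤ.* γ j)) ⟨
  ℤΣ.sum (λ i → λᵥ i ℤ.* (μ* μ w · γ) i) ∎
  where open ≡-Reasoning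

-- Counting first occurrences

module ReflectionComplexity (S : NumSys) (β : ℕ) (digits<β : ∀ n → All (_< β) (rep S n))
         (adder : DFA (ℕ × ℕ × ℕ)) (adder-correct : ∀ w → DFA.Accepts adder w ⇔ AddLanguage S w)
         {m} (x : ℕ → Fin m) (X : DFAO ℕ (Fin m)) (x≡ : ∀ n → x n ≡ DFAO.output X (rep S n)) where
  open Representation S
  open AutomaticRelations S β digits<β adder adder-correct
  open FactorEquivalence Fin._≟_ x
  open AutomaticFactorRelations S β digits<β adder adder-correct x X x≡
  open Equivalence

  pairs : List ℕ → List ℕ → List (Vec ℕ 2)
  pairs = zipWith (λ a b → a ∷ᵛ b ∷ᵛ []ᵛ)

  private
    track₀-pairs : ∀ e w → length e ≡ length w → track (# 0) (pairs e w) ≡ e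
    track₀-pairs []      []      _    = refl
    track₀-pairs (a ∷ e) (b ∷ w) |e|≡ = cong (a ∷_) (track₀-pairs e w (suc-injective |e|≡))

    track₁-pairs : ∀ e w → length e ≡ length w → track (# 1) (pairs e w) ≡ w
    track₁-pairs []      []      _    = refl
    track₁-pairs (a ∷ e) (b ∷ w) |e|≡ = cong (b ∷_) (track₁-pairs e w (suc-injective |e|≡))

  Encodes-pairs : ∀ {e w i n} → length e ≡ length w → IsPaddedRep S e i → IsPaddedRep S w n →
    Encodes (pairs e w) (i ∷ᵛ n ∷ᵛ []ᵛ)
  Encodes-pairs {e} {w} {i} {n} |e|≡ pi pn = encodes λ where
    fzero        → subst (λ z → IsPaddedRep S z i) (sym (track₀-pairs e w |e|≡)) pi
    (fsuc fzero) → subst (λ z → IsPaddedRep S z n) (sym (track₁-pairs e w |e|≡)) pn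

  private
    firstOccurrence-of-n : Automatic 2 (λ ns → FirstOccurrence (ns ! # 1) (ns ! # 0))
    firstOccurrence-of-n = reindex-automatic (# 1 ∷ᵛ # 0 ∷ᵛ []ᵛ) FirstOccurrence-automatic

  -- opaque: its states are nested subset constructions, and unfolding them makes type checking blow up
  opaque
    𝒜 : Automaton (Vec ℕ 2)
    𝒜 = automaton firstOccurrence-of-n ∩ᴬ number (# 0)

  opaque
    unfolding 𝒜
    Accepts-𝒜 : ∀ {e w n} → length e ≡ length w → IsPaddedRep S w n →
      Accepts 𝒜 (pairs e w) ⇔ (∃ λ i → IsPaddedRep S e i × FirstOccurrence n i)
    Accepts-𝒜 {e} {w} {n} |e|≡ pn = mk⇔ ⇒ ⇐
      where
        ⇒ : Accepts 𝒜 (pairs e w) → ∃ λ i → IsPaddedRep S e i × FirstOccurrence n i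
        ⇒ acc =
          let acc-first , acc-number = to (Accepts-∩ (automaton firstOccurrence-of-n) (number (# 0)) (pairs e w)) acc
              i , pi′ = Accepts-number⁻ (# 0) (pairs e w) acc-number
              pi = subst (λ z → IsPaddedRep S z i) (track₀-pairs e w |e|≡) pi′
          in i , pi , to (recognises firstOccurrence-of-n (Encodes-pairs |e|≡ pi pn)) acc-first
        ⇐ : (∃ λ i → IsPaddedRep S e i × FirstOccurrence n i) → Accepts 𝒜 (pairs e w)
        ⇐ (i , pi , first) = from (Accepts-∩ (automaton firstOccurrence-of-n) (number (# 0)) (pairs e w))
          (from (recognises firstOccurrence-of-n (Encodes-pairs |e|≡ pi pn)) first ,
           Accepts-number⁺ (# 0) (pairs e w) (tracks (Encodes-pairs |e|≡ pi pn) (# 0)))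

  open Automaton 𝒜 using (State; start; step; accepting; run; finite)
  open Finite finite using (size; index; element; element-index)

  pairs-zeros++ : ∀ u r w → pairs (u ++ r) (replicate (length u) 0 ++ w) ≡ map lift u ++ pairs r w
  pairs-zeros++ []      r w = refl
  pairs-zeros++ (d ∷ u) r w = cong (lift d ∷_) (pairs-zeros++ u r w)

  Accepts-pairs-zeros++ : ∀ u r w →
    Accepts 𝒜 (pairs (u ++ r) (replicate (length u) 0 ++ w)) ≡ T (accepting (run (foldl (liftedStep 𝒜) start u) (pairs r w)))
  Accepts-pairs-zeros++ u r w = cong (T ∘ accepting) (trans (cong (run start) (pairs-zeros++ u r w)) (run-lifted++ 𝒜 start u (pairs r w)))

  -- a too long first occurrence i is pumped in the part of rep_U(i) that is read against zeros
  module Pumping {n i} (first : FirstOccurrence n i) (long : size + length (rep S n) < length (rep S i)) where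
    ℓₙ = length (rep S n)
    p = length (rep S i) ∸ ℓₙ
    u = take p (rep S i)
    r = drop p (rep S i)

    ℓₙ≤ : ℓₙ ≤ length (rep S i)
    ℓₙ≤ = ≤-trans (m≤n+m ℓₙ size) (<⇒≤ long)

    |u|≡p : length u ≡ p
    |u|≡p = trans (length-take p (rep S i)) (m≤n⇒m⊓n≡m (m∸n≤m _ ℓₙ))

    |r|≡ℓₙ : length r ≡ ℓₙ
    |r|≡ℓₙ = trans (length-drop p (rep S i)) (m∸[m∸n]≡n ℓₙ≤)

    size<|u| : size < length u
    size<|u| = subst (size <_) (sym |u|≡p) (+-cancelʳ-< ℓₙ size p (subst (size + ℓₙ <_) (sym (m∸n+n≡m ℓₙ≤)) long))

    length-padded : ∀ u′ → length (u′ ++ r) ≡ length (replicate (length u′) 0 ++ rep S n)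
    length-padded u′ = trans (length-++ u′) (trans (cong (λ k → length u′ + k) |r|≡ℓₙ) (sym (length-replicate++ (length u′) (rep S n))))

    accepted : T (accepting (run (foldl (liftedStep 𝒜) start u) (pairs r (rep S n))))
    accepted = subst id (Accepts-pairs-zeros++ u r (rep S n))
      (from (Accepts-𝒜 (length-padded u) (zeros++-isPadded _ (rep-isPadded n)))
            (i , subst (λ z → IsPaddedRep S z i) (sym (take++drop≡id p (rep S i))) (rep-isPadded i) , first))

    module Decomposed (x′ y z : List ℕ) (u≡ : u ≡ x′ ++ y ++ z) (0<|y| : 0 < length y)
          (pump : ∀ N → foldl (liftedStep 𝒜) start (x′ ++ concat (replicate N y) ++ z) ≡ foldl (liftedStep 𝒜) start u) where
      pumped : ℕ → List ℕ
      pumped N = x′ ++ concat (replicate (suc N) y) ++ z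

      pumped-first : ∀ N → ∃ λ j → IsPaddedRep S (pumped N ++ r) j × FirstOccurrence n j
      pumped-first N = to (Accepts-𝒜 (length-padded (pumped N)) (zeros++-isPadded _ (rep-isPadded n)))
        (subst id (sym (Accepts-pairs-zeros++ (pumped N) r (rep S n)))
          (subst (λ q → T (accepting (run q (pairs r (rep S n))))) (sym (pump (suc N))) accepted))

      position : ℕ → ℕ
      position N = proj₁ (pumped-first N)

      position-first : ∀ N → FirstOccurrence n (position N)
      position-first N = proj₂ (proj₂ (pumped-first N))

      private
        c = proj₁ (++-nonempty x′ y 0<|y|)
        cs = proj₁ (proj₂ (++-nonempty x′ y 0<|y|))

        leading : ∀ t → x′ ++ y ++ t ≡ c ∷ cs ++ t
        leading t = trans (sym (++-assoc x′ y t)) (cong (_++ t) (proj₂ (proj₂ (++-nonempty x′ y 0<|y|))))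

        rep-i≡ : rep S i ≡ x′ ++ y ++ z ++ r
        rep-i≡ = begin
          rep S i               ≡⟨ take++drop≡id p (rep S i) ⟨
          u ++ r                ≡⟨ cong (_++ r) u≡ ⟩
          (x′ ++ y ++ z) ++ r   ≡⟨ ++-assoc x′ (y ++ z) r ⟩
          x′ ++ (y ++ z) ++ r   ≡⟨ cong (x′ ++_) (++-assoc y z r) ⟩
          x′ ++ y ++ z ++ r     ∎
          where open ≡-Reasoning

        c≢0 : c ≢ 0
        c≢0 = rep-leading≢0 i (trans rep-i≡ (leading (z ++ r)))

        pumped++r≡ : ∀ N → pumped N ++ r ≡ x′ ++ y ++ concat (replicate N y) ++ z ++ r
        pumped++r≡ N = begin
          (x′ ++ (y ++ Y) ++ z) ++ r   ≡⟨ ++-assoc x′ ((y ++ Y) ++ z) r ⟩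
          x′ ++ ((y ++ Y) ++ z) ++ r   ≡⟨ cong (x′ ++_) (++-assoc (y ++ Y) z r) ⟩
          x′ ++ (y ++ Y) ++ z ++ r     ≡⟨ cong (x′ ++_) (++-assoc y Y (z ++ r)) ⟩
          x′ ++ y ++ Y ++ z ++ r       ∎
          where
            open ≡-Reasoning
            Y = concat (replicate N y)

        rep-position : ∀ N → pumped N ++ r ≡ rep S (position N)
        rep-position N = trans pumped++r≡c∷
          (leading≢0-padded⇒rep (subst (λ w → IsPaddedRep S w (position N)) pumped++r≡c∷ (proj₁ (proj₂ (pumped-first N)))) c≢0)
          where
            pumped++r≡c∷ : pumped N ++ r ≡ c ∷ cs ++ concat (replicate N y) ++ z ++ r
            pumped++r≡c∷ = trans (pumped++r≡ N) (leading (concat (replicate N y) ++ z ++ r))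

        length-pumped++r : ∀ N → length (pumped N ++ r) ≡ length x′ + (suc N * length y + length z) + length r
        length-pumped++r N = begin
          length (pumped N ++ r)                                        ≡⟨ length-++ (pumped N) ⟩
          length (pumped N) + length r                                  ≡⟨ cong (_+ length r) (length-++ x′) ⟩
          length x′ + length (concat (replicate (suc N) y) ++ z) + length r
            ≡⟨ cong (λ k → length x′ + k + length r)
                    (trans (length-++ (concat (replicate (suc N) y))) (cong (_+ length z) (length-concat-replicate (suc N) y))) ⟩
          length x′ + (suc N * length y + length z) + length r           ∎
          where open ≡-Reasoning

      -- the pumped words keep the nonzero leading digit of rep_U(i), so they are genuine
      -- representations, and their lengths separate the positions
      position-injective : ∀ {N N′} → position N ≡ position N′ → N ≡ N′
      position-injective {N} {N′} same = suc-injective (*-cancelʳ-≡ (suc N) (suc N′) (length y) {{>-nonZero 0<|y|}}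
        (+-cancelʳ-≡ (length z) _ _ (+-cancelˡ-≡ (length x′) _ _ (+-cancelʳ-≡ (length r) _ _
          (trans (sym (length-pumped++r N)) (trans lengths≡ (length-pumped++r N′)))))))
        where
          lengths≡ : length (pumped N ++ r) ≡ length (pumped N′ ++ r)
          lengths≡ = cong length (trans (rep-position N) (trans (cong (rep S) same) (sym (rep-position N′))))

      impossible : ⊥
      impossible = 1+n≰n (subst (_≤ length (allWords (allFin m) n)) (trans (length-map position (upTo K)) (length-upTo K))
        (firstOccurrences-few (Fin-finite m) n (Unique.map⁺ position-injective (Unique.upTo⁺ K))
                                               (Allₚ.map⁺ (All.universal position-first (upTo K)))))
        where K = suc (length (allWords (allFin m) n))

    impossible : ⊥
    impossible = decomposed-impossible (run-pumping finite (liftedStep 𝒜) start u size<|u|)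
      where
        decomposed-impossible : (∃ λ x′ → ∃ λ y → ∃ λ z → u ≡ x′ ++ y ++ z × 0 < length y ×
          (∀ N → foldl (liftedStep 𝒜) start (x′ ++ concat (replicate N y) ++ z) ≡ foldl (liftedStep 𝒜) start u)) → ⊥
        decomposed-impossible (x′ , y , z , u≡ , 0<|y| , pump) = Decomposed.impossible x′ y z u≡ 0<|y| pump

  firstOccurrence-short : ∀ {n i} → FirstOccurrence n i → length (rep S i) ≤ size + length (rep S n)
  firstOccurrence-short {n} {i} first = case length (rep S i) ≤? size + length (rep S n) of λ where
    (yes short) → short
    (no ¬short) → ⊥-elim (Pumping.impossible first (≰⇒> ¬short))

  digitWords : ℕ → List (List ℕ)
  digitWords = allWords (upTo β)

  acceptedCount : State → List ℕ → ℕ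
  acceptedCount q w = count (λ e → accepting (run q (pairs e w))) (digitWords (length w))

  acceptedCount-∷ : ∀ q c w → acceptedCount q (c ∷ w) ≡ sum (map (λ d → acceptedCount (step q (d ∷ᵛ c ∷ᵛ []ᵛ)) w) (upTo β))
  acceptedCount-∷ q c w = sum-cartesianProduct∷ (λ e → indicator (accepting (run q (pairs e (c ∷ w))))) (upTo β) (digitWords (length w))

  acceptedCount-zeros++ : ∀ k q w →
    sum (map (λ u → acceptedCount (foldl (liftedStep 𝒜) q u) w) (digitWords k)) ≡ acceptedCount q (replicate k 0 ++ w)
  acceptedCount-zeros++ zero    q w = +-identityʳ (acceptedCount q w)
  acceptedCount-zeros++ (suc k) q w = begin
    sum (map (λ u → acceptedCount (foldl (liftedStep 𝒜) q u) w) (cartesianProductWith _∷_ (upTo β) (digitWords k)))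
      ≡⟨ sum-cartesianProduct∷ (λ u → acceptedCount (foldl (liftedStep 𝒜) q u) w) (upTo β) (digitWords k) ⟩
    sum (map (λ d → sum (map (λ u → acceptedCount (foldl (liftedStep 𝒜) (liftedStep 𝒜 q d) u) w) (digitWords k))) (upTo β))
      ≡⟨ cong sum (map-cong (λ d → acceptedCount-zeros++ k (liftedStep 𝒜 q d) w) (upTo β)) ⟩
    sum (map (λ d → acceptedCount (liftedStep 𝒜 q d) (replicate k 0 ++ w)) (upTo β))
      ≡⟨ acceptedCount-∷ q 0 (replicate k 0 ++ w) ⟨
    acceptedCount q (replicate (suc k) 0 ++ w) ∎
    where open ≡-Reasoning

  μ : ℕ → Mat size
  μ c i k = + count (λ d → does (index (step (element i) (d ∷ᵛ c ∷ᵛ []ᵛ)) Fin.≟ k)) (upTo β)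

  γ : Fin size → ℤ
  γ k = + indicator (accepting (element k))

  λᵥ : Fin size → ℤ
  λᵥ k = + count (λ u → does (index (foldl (liftedStep 𝒜) start u) Fin.≟ k)) (digitWords size)

  μ*·γ : ∀ w i → (μ* μ w · γ) i ≡ + acceptedCount (element i) w
  μ*·γ []      i = trans (idMat-· γ i) (cong +_ (sym (+-identityʳ _)))
  μ*·γ (c ∷ w) i = begin
    ((μ c ⊗ μ* μ w) · γ) i
      ≡⟨ ⊗-· (μ c) (μ* μ w) γ i ⟩
    ℤΣ.sum (λ k → μ c i k ℤ.* (μ* μ w · γ) k)
      ≡⟨ ℤΣ.sum-cong-≗ (λ k → cong (μ c i k ℤ.*_) (μ*·γ w k)) ⟩
    ℤΣ.sum (λ k → μ c i k ℤ.* + acceptedCount (element k) w)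
      ≡⟨ ∑-count-pos next (λ k → acceptedCount (element k) w) (upTo β) ⟩
    + sum (map (λ d → acceptedCount (element (next d)) w) (upTo β))
      ≡⟨ cong +_ (cong sum (map-cong (λ d → cong (λ q → acceptedCount q w) (element-index _)) (upTo β))) ⟩
    + sum (map (λ d → acceptedCount (step (element i) (d ∷ᵛ c ∷ᵛ []ᵛ)) w) (upTo β))
      ≡⟨ cong +_ (acceptedCount-∷ (element i) c w) ⟨
    + acceptedCount (element i) (c ∷ w) ∎
    where
      open ≡-Reasoning
      next : ℕ → Fin size
      next d = index (step (element i) (d ∷ᵛ c ∷ᵛ []ᵛ))

  evalRep≡acceptedCount : ∀ w → evalRep λᵥ μ γ w ≡ + acceptedCount start (replicate size 0 ++ w)
  evalRep≡acceptedCount w = begin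
    evalRep λᵥ μ γ w
      ≡⟨ evalRep-· λᵥ μ γ w ⟩
    ℤΣ.sum (λ i → λᵥ i ℤ.* (μ* μ w · γ) i)
      ≡⟨ ℤΣ.sum-cong-≗ (λ i → cong (λᵥ i ℤ.*_) (μ*·γ w i)) ⟩
    ℤΣ.sum (λ i → λᵥ i ℤ.* + acceptedCount (element i) w)
      ≡⟨ ∑-count-pos reached (λ i → acceptedCount (element i) w) (digitWords size) ⟩
    + sum (map (λ u → acceptedCount (element (reached u)) w) (digitWords size))
      ≡⟨ cong +_ (cong sum (map-cong (λ u → cong (λ q → acceptedCount q w) (element-index _)) (digitWords size))) ⟩
    + sum (map (λ u → acceptedCount (foldl (liftedStep 𝒜) start u) w) (digitWords size))
      ≡⟨ cong +_ (acceptedCount-zeros++ size start w) ⟩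
    + acceptedCount start (replicate size 0 ++ w) ∎
    where
      open ≡-Reasoning
      reached : List ℕ → Fin size
      reached u = index (foldl (liftedStep 𝒜) start u)

  paddedRep : ℕ → List ℕ
  paddedRep n = replicate size 0 ++ rep S n

  ℓ : ℕ → ℕ
  ℓ n = length (paddedRep n)

  firstOccurrences : ℕ → List ℕ
  firstOccurrences n = filter (firstOccurrence? n) (upTo (NumSys.U S (ℓ n)))

  acceptedCount≡length-firstOccurrences : ∀ n → acceptedCount start (paddedRep n) ≡ length (firstOccurrences n)
  acceptedCount≡length-firstOccurrences n = begin
    acceptedCount start (paddedRep n)
      ≡⟨ count≡length-filter accepts (digitWords (ℓ n)) ⟩
    length acceptedWords
      ≡⟨ ≤-antisym (Unique⇒length≤ acceptedWords! acceptedWords⊆) (Unique⇒length≤ padded! padded⊆) ⟩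
    length (map (pad (ℓ n)) (firstOccurrences n))
      ≡⟨ length-map (pad (ℓ n)) (firstOccurrences n) ⟩
    length (firstOccurrences n) ∎
    where
      open ≡-Reasoning
      accepts : List ℕ → Bool
      accepts e = accepting (run start (pairs e (paddedRep n)))
      acceptedWords = filter (T? ∘ accepts) (digitWords (ℓ n))
      paddedRep-isPadded : IsPaddedRep S (paddedRep n) n
      paddedRep-isPadded = zeros++-isPadded size (rep-isPadded n)

      acceptedWords! : Unique acceptedWords
      acceptedWords! = Unique.filter⁺ (T? ∘ accepts) (allWords-unique (Unique.upTo⁺ β) (ℓ n))
      padded! : Unique (map (pad (ℓ n)) (firstOccurrences n))
      padded! = Unique.map⁺ pad-injective (Unique.filter⁺ (firstOccurrence? n) (Unique.upTo⁺ (NumSys.U S (ℓ n))))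

      acceptedWords⊆ : All (_∈ map (pad (ℓ n)) (firstOccurrences n)) acceptedWords
      acceptedWords⊆ = All.tabulate λ {e} e∈ →
        let e∈words , acc = ∈-filter⁻ (T? ∘ accepts) e∈
            |e|≡ℓ , _ = ∈-allWords⁻ (upTo β) (ℓ n) e∈words
            i , pi , first = to (Accepts-𝒜 |e|≡ℓ paddedRep-isPadded) acc
            i<U = length-rep≤⇒<U i (ℓ n) (subst (length (rep S i) ≤_) |e|≡ℓ (padded⇒length-rep≤ pi))
        in subst (_∈ map (pad (ℓ n)) (firstOccurrences n)) (sym (trans (padded⇒≡pad pi) (cong (λ k → pad k i) |e|≡ℓ)))
             (∈-map⁺ (pad (ℓ n)) (∈-filter⁺ (firstOccurrence? n) (∈-upTo⁺ i<U) first))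

      padded⊆ : All (_∈ acceptedWords) (map (pad (ℓ n)) (firstOccurrences n))
      padded⊆ = Allₚ.map⁺ (All.tabulate λ {i} i∈ →
        let i∈upTo , first = ∈-filter⁻ (firstOccurrence? n) i∈
            |pad|≡ℓ = length-pad (ℓ n) i (<U⇒length-rep≤ i (ℓ n) (∈-upTo⁻ i∈upTo))
            pad<β = Allₚ.++⁺ (Allₚ.replicate⁺ _ (alphabet-nonempty digits<β)) (digits<β i)
            pad∈words = subst (λ k → pad (ℓ n) i ∈ digitWords k) |pad|≡ℓ (∈-allWords⁺ (All.map ∈-upTo⁺ pad<β))
        in ∈-filter⁺ (T? ∘ accepts) pad∈words (from (Accepts-𝒜 |pad|≡ℓ paddedRep-isPadded) (i , pad-isPadded (ℓ n) i , first)))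

  r : ℕ → ℕ
  r n = length (firstOccurrences n)

  reflectionComplexity : ∀ n → IsReflComplexity x n (r n)
  reflectionComplexity n = map (λ i → factor x i n) (firstOccurrences n) , length-map _ (firstOccurrences n) , factors , inequivalent , covering
    where
      factors : All (IsFactor x n) (map (λ i → factor x i n) (firstOccurrences n))
      factors = Allₚ.map⁺ (All.universal (λ i → i , refl) (firstOccurrences n))
      inequivalent : AllPairs (λ u v → ¬ (u ≈ v)) (map (λ i → factor x i n) (firstOccurrences n))
      inequivalent = AllPairsₚ.map⁺ (AllPairs-map-All firstOccurrences-inequivalent
        (Unique.filter⁺ (firstOccurrence? n) (Unique.upTo⁺ (NumSys.U S (ℓ n)))) (Allₚ.all-filter (firstOccurrence? n) (upTo (NumSys.U S (ℓ n)))))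
      covering : ∀ i → Any (factor x i n ≈_) (map (λ i → factor x i n) (firstOccurrences n))
      covering i =
        let j , first , j≈i = earliest-equivalent n i
            rep-j-short = subst (length (rep S j) ≤_) (sym (length-replicate++ size (rep S n))) (firstOccurrence-short first)
        in Anyₚ.map⁺ (lose (∈-filter⁺ (firstOccurrence? n) (∈-upTo⁺ (length-rep≤⇒<U j (ℓ n) rep-j-short)) first) (≈-sym j≈i))

  linearRepresentation : LinRep
  linearRepresentation = record { dim = size ; dim≥1 = nonempty (Finite.complete finite start) ; λv = λᵥ ; μ = μ ; γ = γ }
    where
      nonempty : ∀ {q qs} → q ∈ qs → 1 ≤ length qs
      nonempty (here _)  = s≤s z≤n
      nonempty (there _) = s≤s z≤n

  represents : Represents S linearRepresentation (λ n → + r n)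
  represents n = sym (trans (evalRep≡acceptedCount (rep S n)) (cong +_ (acceptedCount≡length-firstOccurrences n)))

theorem8p1 : (S : NumSys) → HasAdder S → (m : ℕ) → (x : ℕ → Fin m) →
    IsAutomatic S x →
    Σ (ℕ → ℕ) λ r → (∀ n → IsReflComplexity x n (r n)) ×
      IsRegular S (λ n → + (r n))
theorem8p1 S (β , digits<β , adder , adder-correct) m x (X , x≡) =
  r , reflectionComplexity , linearRepresentation , represents
  where open ReflectionComplexity S β digits<β adder adder-correct x X x≡
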